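{- For every fixed integer $k\ge2$, the approximation ratio of the $k$-Opt algorithm for \textsc{Graph TSP} is $\Omega\!\left(\frac{\log n}{\log\log n}\right)$, where $n$ is the number of vertices.
   Context: A \textsc{Graph TSP} instance arises from a connected unweighted undirected graph $G$: it is the complete graph on $V(G)$ where the cost of $\{u,v\}$ is the length of a shortest $u$-$v$ path in $G$. A tour is a Hamiltonian cycle. A $k$-move replaces at most $k$ edges of a tour by other edges to get a new tour; a tour is $k$-optimal if no $k$-move yields a shorter tour. The approximation ratio of $k$-Opt on $n$-vertex instances is the supremum over all $n$-vertex instances and all $k$-optimal tours $T$ of $c(T)/c(T^*)$, $T^*$ an optimal tour. -}

module Defs where

open import Data.Bool using (Bool; true; false; _∧_; _∨_; if_then_else_; T)
open import Data.Nat using (ℕ; zero; suc; _+_; _*_; _≤_)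
open import Data.Nat.DivMod using (_%_; m%n<n)
open import Data.Fin using (Fin; toℕ; fromℕ<; _≟_)
open import Data.Fin.Permutation using (Permutation′; _⟨$⟩ʳ_)
open import Data.List using (List; map; allFin)
open import Data.Bool.ListAction using (any)
open import Data.Nat.ListAction using (sum)
open import Data.Product using (∃; _×_)
open import Relation.Nullary.Decidable using (⌊_⌋)
open import Relation.Binary.PropositionalEquality using (_≡_)

record Graph (n : ℕ) : Set where
  field
    adj    : Fin n → Fin n → Bool
    sym    : ∀ u v → adj u v ≡ adj v u
    irrefl : ∀ u → adj u u ≡ false
open Graph public

reach : ∀ {n} → Graph n → ℕ → Fin n → Fin n → Bool
reach G zero    u v = ⌊ u ≟ v ⌋
reach G (suc ℓ) u v = reach G ℓ u v ∨ any (λ w → adj G u w ∧ reach G ℓ w v) (allFin _)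

Connected : ∀ {n} → Graph n → Set
Connected G = ∀ u v → ∃ λ ℓ → reach G ℓ u v ≡ true

distSearch : ∀ {n} → Graph n → Fin n → Fin n → (fuel start : ℕ) → ℕ
distSearch G u v zero       start = start
distSearch G u v (suc fuel) start =
  if reach G start u v then start else distSearch G u v fuel (suc start)

-- Shortest-path distance in G (correct for connected G, where it is < n).
dist : ∀ {n} → Graph n → Fin n → Fin n → ℕ
dist {n} G u v = distSearch G u v n 0

next : ∀ {m} → Fin (suc m) → Fin (suc m)
next {m} i = fromℕ< (m%n<n (suc (toℕ i)) (suc m))

-- A tour (Hamiltonian cycle on the complete graph on Fin (suc m)) is given by
-- a cyclic ordering of the vertices: position i ↦ vertex.
Tour : ℕ → Set
Tour m = Permutation′ (suc m)

edgeFst edgeSnd : ∀ {m} → Tour m → Fin (suc m) → Fin (suc m)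
edgeFst π i = π ⟨$⟩ʳ i
edgeSnd π i = π ⟨$⟩ʳ next i

cost : ∀ {m} → Graph (suc m) → Tour m → ℕ
cost G π = sum (map (λ i → dist G (edgeFst π i) (edgeSnd π i)) (allFin _))

inTour : ∀ {m} → Tour m → Fin (suc m) → Fin (suc m) → Bool
inTour π a b = any (λ j → (⌊ a ≟ edgeFst π j ⌋ ∧ ⌊ b ≟ edgeSnd π j ⌋)
                        ∨ (⌊ a ≟ edgeSnd π j ⌋ ∧ ⌊ b ≟ edgeFst π j ⌋)) (allFin _)

removed : ∀ {m} → Tour m → Tour m → ℕ
removed π π' = sum (map (λ i → if inTour π' (edgeFst π i) (edgeSnd π i) then 0 else 1) (allFin _))

KMove : ∀ {m} → ℕ → Tour m → Tour m → Set
KMove k π π' = removed π π' ≤ k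

KOptimal : ∀ {m} → ℕ → Graph (suc m) → Tour m → Set
KOptimal k G π = ∀ π' → KMove k π π' → cost G π ≤ cost G π'

Optimal : ∀ {m} → Graph (suc m) → Tour m → Set
Optimal G π = ∀ π' → cost G π ≤ cost G π'

{-# OPTIONS --safe #-}
-- A tour whose edges are shadowed by pairwise edge-disjoint trails of length at most L in a
-- graph of girth at least 2kL is k-optimal: if a k-move were improving, the trails of the
-- removed edges together with geodesics for the added edges would form a closed chain mod 2
-- of fewer than 2kL edges, so every edge of it would be used an even number of times, and
-- the geodesics would have to cover all trails.
-- Such a graph on any number n of vertices, with trails of total length ≥ cnL for some L of
-- order log n / log log n, is built greedily: start with a Hamiltonian cycle (the optimal
-- tour, of cost n) and extend a walk by edges to low-degree vertices outside the ball of
-- radius 2kL; every L-th vertex is the next stop of the tour. With maximum degree O(L) the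
-- balls have at most n/32 vertices. Once n/8 vertices have been visited in this way, the
-- tour closes up along the cycle, where the skipped vertices are pairwise non-adjacent.

module Submission where

open import Defs hiding (sym)
open import Algebra.Bundles using (CommutativeMonoid; CommutativeRing)
import Algebra.Properties.CommutativeMonoid.Sum as CMSum
open import Data.Bool using (Bool; true; false; not; _∧_; _∨_; _xor_; if_then_else_)
open import Data.Bool.ListAction using (any)
open import Data.Bool.Properties
  using (xor-assoc; xor-comm; xor-same; xor-identityʳ; ∨-comm; ∨-zeroʳ; xor-∧-commutativeRing; ⇔→≡)
open import Data.Fin using (Fin; zero; suc; toℕ; fromℕ; inject₁; _≟_)
open import Data.Fin.Induction using (<-weakInduction)
open import Data.Fin.Permutation
  using (Permutation′; _⟨$⟩ʳ_; _⟨$⟩ˡ_; permutation; inverseˡ; Permutation; ↔⇒≡) renaming (id to idₚ)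
open import Data.Fin.Properties using (toℕ-injective; toℕ-fromℕ<; toℕ-fromℕ; toℕ-inject₁; toℕ<n)
open import Data.Fin.Relation.Unary.Top using (view; ‵fromℕ; ‵inj₁)
open import Data.List
  using (List; []; _∷_; _++_; length; map; concatMap; allFin; tabulate; filter; lookup)
import Data.List.Membership.DecPropositional as DecMembership
open import Data.List.Membership.Propositional using (_∈_; _∉_; find; lose)
open import Data.List.Membership.Propositional.Properties
  using (∈-++⁺ˡ; ∈-++⁺ʳ; ∈-++⁻; ∈-concatMap⁺; ∈-concatMap⁻; ∈-allFin; ∈-map⁺; ∈-map⁻;
         ∈-∃++; ∈-lookup; ∈-filter⁺; ∈-filter⁻)
open import Data.List.Properties
  using (++-assoc; ++-identityʳ; length-++; length-map; length-tabulate;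
         map-tabulate; filter-accept; filter-reject)
open import Data.List.Relation.Binary.Sublist.Propositional
  using (_⊆_; []; _∷_; _∷ʳ_; ⊆-refl; minimum; ⊆-trans)
open import Data.List.Relation.Binary.Sublist.Propositional.Properties using (All-resp-⊆; ++⁺)
open import Data.List.Relation.Unary.All as All using (All; []; _∷_)
import Data.List.Relation.Unary.All.Properties as All
open import Data.List.Relation.Unary.AllPairs using ([]; _∷_)
open import Data.List.Relation.Unary.Any using (here; there; index)
open import Data.List.Relation.Unary.Any.Properties using (lookup-index)
open import Data.List.Relation.Unary.Unique.Propositional using (Unique)
import Data.List.Relation.Unary.Unique.Propositional.Properties as Unique
open import Data.Nat hiding (_≟_)
open import Data.Nat.DivMod
  using (_%_; m<n⇒m%n≡m; n%n≡0; _/_; m≡m%n+[m/n]*n; m%n<n; m/n*n≤m; m*n/n≡m; /-monoˡ-≤)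
open import Data.Nat.Induction using (<-rec)
open import Data.Nat.ListAction using () renaming (sum to sumᴸ)
open import Data.Nat.Logarithm using (⌊log₂_⌋; ⌊log₂⌋-mono-≤; ⌊log₂⌊n/2⌋⌋≡⌊log₂n⌋∸1; ⌊log₂[2^n]⌋≡n)
open import Data.Nat.Properties hiding (_≟_)
open import Data.Nat.Tactic.RingSolver using (solve-∀)
open import Data.Product using (Σ; ∃; ∃₂; _×_; _,_; proj₁; proj₂)
open import Data.Product.Properties using (≡-dec)
open import Data.Sum using (_⊎_; inj₁; inj₂)
open import Function using (_∘_)
open import Function.Bundles using (mk⇔)
open import Level using (0ℓ)
open import Relation.Binary.Definitions using (DecidableEquality)
open import Relation.Binary.PropositionalEquality
open import Relation.Nullary using (does; yes; no; contradiction; Dec)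
open import Relation.Nullary.Decidable using (dec-true; dec-false; does-⇔; ⌊_⌋; ¬?)

-- Paths are replaced by edge lists with a prescribed mod 2 boundary. Concatenation adds boundaries
-- and edges may repeat, so no cycle ever has to be extracted: girth becomes a statement on parities
-- of multiplicities, and distance a lower bound on the length of chains with two given end points.
-- The obstacle in the greedy construction is the closing edge. Each new edge keeps the girth
-- because its ends are far apart, but the tour must also return from the end `w` of the walk to
-- vertex 0. So every step avoids a ball around 0 as well; the guaranteed distance from 0 to the
-- current end then grows by one per step until it reaches `g`, and the edge between 0 and `w` can
-- be added like the others. The double logarithm stems from the balls: with degrees of order `L`
-- and girth `2kL` their size is about `L ^ (2kL)`, which is a small fraction of `n` only if
-- `k L log L` is at most of order `log n`.

private
  variable
    n : ℕ
    E Z Z' : List (Fin n × Fin n)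

-- Chains modulo 2

Edge : ℕ → Set
Edge n = Fin n × Fin n

_≟ᵉ_ : DecidableEquality (Edge n)
_≟ᵉ_ = ≡-dec _≟_ _≟_

δ : Fin n → Fin n → Bool
δ u v = does (u ≟ v)

ends : Edge n → Fin n → Bool
ends (a , b) v = δ a v xor δ b v

∂ : List (Edge n) → Fin n → Bool
∂ []      v = false
∂ (e ∷ Z) v = ends e v xor ∂ Z v

odd : Edge n → List (Edge n) → Bool
odd f []      = false
odd f (e ∷ Z) = does (e ≟ᵉ f) xor odd f Z

Over : List (Edge n) → List (Edge n) → Set
Over E Z = All (_∈ E) Z

Closed : List (Edge n) → Set
Closed Z = ∀ v → ∂ Z v ≡ false

Joins : Fin n → Fin n → List (Edge n) → Set
Joins a b Z = ∀ v → ∂ Z v ≡ ends (a , b) v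

-- Chains are multisets of edges; allowing repetitions here avoids any reduction mod 2
-- when trails and walks are concatenated.
Girth : List (Edge n) → ℕ → Set
Girth E g = ∀ Z → Over E Z → Closed Z → length Z < g → ∀ f → odd f Z ≡ false

-- Distance at least `r`. A chain with boundary `a + b` contains a path between them, so quantifying
-- over all chains asks for nothing more.
Separated : List (Edge n) → Fin n → Fin n → ℕ → Set
Separated E a b r = ∀ Z → Over E Z → Joins a b Z → r ≤ length Z

xor-swap : ∀ a b c → a xor (b xor c) ≡ b xor (a xor c)
xor-swap a b c = trans (sym (xor-assoc a b c)) (trans (cong (_xor c) (xor-comm a b)) (xor-assoc b a c))

xor-cancelˡ : ∀ a b → a xor (a xor b) ≡ b
xor-cancelˡ a b = trans (sym (xor-assoc a a b)) (cong (_xor b) (xor-same a))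

xor≡false⇒≡ : ∀ a b → a xor b ≡ false → a ≡ b
xor≡false⇒≡ false b eq = sym eq
xor≡false⇒≡ true true eq = refl

∂-++ : ∀ (Z Z' : List (Edge n)) v → ∂ (Z ++ Z') v ≡ ∂ Z v xor ∂ Z' v
∂-++ []      Z' v = refl
∂-++ (e ∷ Z) Z' v = trans (cong (ends e v xor_) (∂-++ Z Z' v)) (sym (xor-assoc (ends e v) _ _))

odd-++ : ∀ f (Z Z' : List (Edge n)) → odd f (Z ++ Z') ≡ odd f Z xor odd f Z'
odd-++ f []      Z' = refl
odd-++ f (e ∷ Z) Z' = trans (cong (does (e ≟ᵉ f) xor_) (odd-++ f Z Z')) (sym (xor-assoc (does (e ≟ᵉ f)) _ _))

odd-∉ : ∀ f (Z : List (Edge n)) → f ∉ Z → odd f Z ≡ false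
odd-∉ f []      f∉ = refl
odd-∉ f (e ∷ Z) f∉ with e ≟ᵉ f
... | yes refl = contradiction (here refl) f∉
... | no _     = odd-∉ f Z (f∉ ∘ there)

odd⇒∈ : ∀ f (Z : List (Edge n)) → odd f Z ≡ true → f ∈ Z
odd⇒∈ f (e ∷ Z) p with e ≟ᵉ f
... | yes refl = here refl
... | no _     = there (odd⇒∈ f Z p)

ends-sym : ∀ (a b v : Fin n) → ends (a , b) v ≡ ends (b , a) v
ends-sym a b v = xor-comm (δ a v) (δ b v)

ends-loop : ∀ (a v : Fin n) → ends (a , a) v ≡ false
ends-loop a v = xor-same (δ a v)

ends-trans : ∀ (a b c v : Fin n) → ends (a , b) v xor ends (b , c) v ≡ ends (a , c) v
ends-trans a b c v = trans (xor-assoc (δ a v) (δ b v) _) (cong (δ a v xor_) (xor-cancelˡ (δ b v) (δ c v)))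

Joins-sym : ∀ {a b : Fin n} → Joins a b Z → Joins b a Z
Joins-sym {a = a} {b} j v = trans (j v) (ends-sym a b v)

Joins-refl : ∀ {a : Fin n} → Joins a a []
Joins-refl {a = a} v = sym (ends-loop a v)

Joins-edge : ∀ {a b : Fin n} → Joins a b ((a , b) ∷ [])
Joins-edge {a = a} {b} v = xor-identityʳ (ends (a , b) v)

Joins-++ : ∀ {a b c : Fin n} → Joins a b Z → Joins b c Z' → Joins a c (Z ++ Z')
Joins-++ {Z = Z} {Z'} {a} {b} {c} p q v =
  trans (∂-++ Z Z' v) (trans (cong₂ _xor_ (p v) (q v)) (ends-trans a b c v))

Joins-∷ : ∀ {a b c : Fin n} → Joins b c Z → Joins a c ((a , b) ∷ Z)
Joins-∷ {a = a} {b} {c} q v = trans (cong (ends (a , b) v xor_) (q v)) (ends-trans a b c v)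

same-ends⇒closed : ∀ {a b : Fin n} → Joins a b Z → Joins a b Z' → Closed (Z ++ Z')
same-ends⇒closed {Z = Z} {Z'} {a} {b} p q v =
  trans (∂-++ Z Z' v) (trans (cong₂ _xor_ (p v) (q v)) (xor-same (ends (a , b) v)))

ends-true : ∀ (a b v : Fin n) → ends (a , b) v ≡ true → (a ≡ v × b ≢ v) ⊎ (b ≡ v × a ≢ v)
ends-true a b v p with a ≟ v | b ≟ v
... | yes q | no ¬q = inj₁ (q , ¬q)
... | no ¬q | yes q = inj₂ (q , ¬q)
ends-true a b v () | yes _ | yes _
ends-true a b v () | no _  | no _

-- A chain has no first edge; a nonzero boundary at `v` selects one that can play this role.
incident : ∀ v (Z : List (Edge n)) → ∂ Z v ≡ true → Over E Z →
           ∃₂ λ e Z' → e ∈ E × ends e v ≡ true × Over E Z' ×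
             (∀ w → ∂ Z w ≡ ends e w xor ∂ Z' w) × length Z ≡ suc (length Z')
incident v (e ∷ Z) p (e∈ ∷ ov) with ends e v in eq
... | true  = e , Z , e∈ , eq , ov , (λ w → refl) , refl
... | false with incident v Z p ov
...   | f , Z' , f∈ , fv , ov' , ∂eq , leq =
  f , e ∷ Z' , f∈ , fv , e∈ ∷ ov' ,
  (λ w → trans (cong (ends e w xor_) (∂eq w)) (xor-swap (ends e w) (ends f w) _)) ,
  cong suc leq

-- Balls

nbrs : List (Edge n) → Fin n → List (Fin n)
nbrs []            x = []
nbrs ((a , b) ∷ E) x = (if δ a x then b ∷ [] else []) ++ (if δ b x then a ∷ [] else []) ++ nbrs E x

deg : List (Edge n) → Fin n → ℕ
deg E x = length (nbrs E x)

-- Enumerates end points of walks, with repetitions; these do no harm, since the length is only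
-- bounded from above.
ball : List (Edge n) → ℕ → Fin n → List (Fin n)
ball E zero    x = x ∷ []
ball E (suc r) x = x ∷ concatMap (ball E r) (nbrs E x)

nbrsˡ : ∀ {a b : Fin n} → (a , b) ∈ E → b ∈ nbrs E a
nbrsˡ {a = a} (here refl) with a ≟ a
... | yes _ = here refl
... | no ¬p = contradiction refl ¬p
nbrsˡ {E = (c , d) ∷ _} {a} (there p) =
  ∈-++⁺ʳ (if δ c a then d ∷ [] else []) (∈-++⁺ʳ (if δ d a then c ∷ [] else []) (nbrsˡ p))

nbrsʳ : ∀ {a b : Fin n} → (a , b) ∈ E → a ∈ nbrs E b
nbrsʳ {a = a} {b} (here refl) with b ≟ b
... | yes _ = ∈-++⁺ʳ (if δ a b then b ∷ [] else []) (here refl)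
... | no ¬p = contradiction refl ¬p
nbrsʳ {E = (c , d) ∷ _} {b = b} (there p) =
  ∈-++⁺ʳ (if δ c b then d ∷ [] else []) (∈-++⁺ʳ (if δ d b then c ∷ [] else []) (nbrsʳ p))

nbrs⁻ : ∀ (E : List (Edge n)) x {w} → w ∈ nbrs E x → (x , w) ∈ E ⊎ (w , x) ∈ E
nbrs⁻ ((a , b) ∷ E) x p with ∈-++⁻ (if δ a x then b ∷ [] else []) p
nbrs⁻ ((a , b) ∷ E) x p | inj₁ q with a ≟ x | q
... | yes refl | here refl = inj₁ (here refl)
... | no _     | ()
nbrs⁻ ((a , b) ∷ E) x p | inj₂ q with ∈-++⁻ (if δ b x then a ∷ [] else []) q
nbrs⁻ ((a , b) ∷ E) x p | inj₂ q | inj₁ r with b ≟ x | r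
... | yes refl | here refl = inj₂ (here refl)
... | no _     | ()
nbrs⁻ ((a , b) ∷ E) x p | inj₂ q | inj₂ r with nbrs⁻ E x r
... | inj₁ s = inj₁ (there s)
... | inj₂ s = inj₂ (there s)

ball-centre : ∀ (E : List (Edge n)) r x → x ∈ ball E r x
ball-centre E zero    x = here refl
ball-centre E (suc r) x = here refl

-- Induction on the radius: splitting off an edge at `x` leaves a chain that joins its other end to
-- `y`.
joins⇒ball : ∀ r {x y : Fin n} Z → Over E Z → Joins x y Z → length Z ≤ r → y ∈ ball E r x
joins⇒ball {E = E} r {x} {y} Z ov j len with x ≟ y
... | yes refl = ball-centre E r x
... | no x≢y with incident x Z ∂x ov
  where
  ∂x : ∂ Z x ≡ true
  ∂x = trans (j x) (cong₂ _xor_ (dec-true (x ≟ x) refl) (dec-false (y ≟ x) (x≢y ∘ sym)))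
joins⇒ball zero    Z ov j len | no _ | _ , _ , _ , _ , _ , _ , leq =
  contradiction (subst (_≤ 0) leq len) λ()
joins⇒ball {E = E} (suc r) {x} {y} Z ov j len | no _ | (a , b) , Z' , e∈ , ex , ov' , ∂eq , leq
  with ends-true a b x ex
... | inj₁ (refl , _) = there (∈-concatMap⁺ (ball E r) (lose (nbrsˡ e∈)
        (joins⇒ball r Z' ov' j' (s≤s⁻¹ (subst (_≤ suc r) leq len)))))
  where
  j' : Joins b y Z'
  j' v = trans (sym (xor-cancelˡ (ends (a , b) v) _))
           (trans (cong (ends (a , b) v xor_) (trans (sym (∂eq v)) (j v)))
             (trans (cong (_xor ends (a , y) v) (ends-sym a b v)) (ends-trans b a y v)))
... | inj₂ (refl , _) = there (∈-concatMap⁺ (ball E r) (lose (nbrsʳ e∈)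
        (joins⇒ball r Z' ov' j' (s≤s⁻¹ (subst (_≤ suc r) leq len)))))
  where
  j' : Joins a y Z'
  j' v = trans (sym (xor-cancelˡ (ends (a , b) v) _))
           (trans (cong (ends (a , b) v xor_) (trans (sym (∂eq v)) (j v))) (ends-trans a b y v))

∉ball⇒separated : ∀ r {x y : Fin n} → y ∉ ball E r x → Separated E x y r
∉ball⇒separated r y∉ Z ov j = ≮⇒≥ λ lt → y∉ (joins⇒ball r Z ov j (<⇒≤ lt))

length-concatMap-≤ : ∀ {A B : Set} (f : A → List B) {s} → (∀ x → length (f x) ≤ s) →
                     ∀ xs → length (concatMap f xs) ≤ length xs * s
length-concatMap-≤ f h []       = z≤n
length-concatMap-≤ f h (x ∷ xs) = subst (_≤ _) (sym (length-++ (f x)))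
  (+-mono-≤ (h x) (length-concatMap-≤ f h xs))

ball-size : ∀ (E : List (Edge n)) {D} → (∀ v → deg E v ≤ D) → ∀ r x → length (ball E r x) ≤ suc D ^ r
ball-size E degD zero    x = ≤-refl
ball-size E {D} degD (suc r) x = +-mono-≤ (m^n>0 (suc D) r)
  (≤-trans (length-concatMap-≤ (ball E r) (ball-size E degD r) (nbrs E x)) (*-monoˡ-≤ (suc D ^ r) (degD x)))

-- Distances in the graph with a given edge list

girth⇒loopless : ∀ {g} → 1 < g → Girth E g → ∀ a → (a , a) ∉ E
girth⇒loopless {g = g} 1<g girth a a∈ = contradiction
  (trans (sym (trans (xor-identityʳ _) (dec-true ((a , a) ≟ᵉ (a , a)) refl)))
    (girth ((a , a) ∷ []) (a∈ ∷ []) (λ v → trans (xor-identityʳ _) (ends-loop a v)) 1<g (a , a)))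
  λ()

_∈ᵇ_ : Edge n → List (Edge n) → Bool
e ∈ᵇ E = does (e ∈? E)
  where open DecMembership _≟ᵉ_ using (_∈?_)

∈ᵇ⁺ : ∀ (e : Edge n) E → e ∈ E → (e ∈ᵇ E) ≡ true
∈ᵇ⁺ e E = dec-true (e ∈? E)
  where open DecMembership _≟ᵉ_ using (_∈?_)

∈ᵇ⁻ : ∀ (e : Edge n) E → (e ∈ᵇ E) ≡ true → e ∈ E
∈ᵇ⁻ e E p with e ∈? E
  where open DecMembership _≟ᵉ_ using (_∈?_)
... | yes q = q

∨-true : ∀ a b → a ∨ b ≡ true → a ≡ true ⊎ b ≡ true
∨-true true  b p = inj₁ refl
∨-true false b p = inj₂ p

∧-true : ∀ a b → a ∧ b ≡ true → a ≡ true × b ≡ true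
∧-true true b p = refl , p

any-true⁺ : ∀ {A : Set} (p : A → Bool) {x xs} → x ∈ xs → p x ≡ true → any p xs ≡ true
any-true⁺ p (here refl) px rewrite px = refl
any-true⁺ p {xs = y ∷ _} (there x∈) px = trans (cong (p y ∨_) (any-true⁺ p x∈ px)) (∨-zeroʳ (p y))

any-true⁻ : ∀ {A : Set} (p : A → Bool) xs → any p xs ≡ true → ∃ λ x → x ∈ xs × p x ≡ true
any-true⁻ p (x ∷ xs) eq with ∨-true (p x) _ eq
... | inj₁ px = x , here refl , px
... | inj₂ q with any-true⁻ p xs q
...   | y , y∈ , py = y , there y∈ , py

edgeGraph : (E : List (Edge n)) → (∀ a → (a , a) ∉ E) → Graph n
edgeGraph E loopless = record
  { adj    = λ u v → ((u , v) ∈ᵇ E) ∨ ((v , u) ∈ᵇ E)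
  ; sym    = λ u v → ∨-comm ((u , v) ∈ᵇ E) ((v , u) ∈ᵇ E)
  ; irrefl = λ u → irr u
  }
  where
  irr : ∀ u → ((u , u) ∈ᵇ E) ∨ ((u , u) ∈ᵇ E) ≡ false
  irr u with (u , u) ∈ᵇ E in eq
  ... | true  = contradiction (∈ᵇ⁻ (u , u) E eq) (loopless u)
  ... | false = refl

reach-refl : ∀ (G : Graph n) ℓ u → reach G ℓ u u ≡ true
reach-refl G zero    u with u ≟ u
... | yes _ = refl
... | no ¬p = contradiction refl ¬p
reach-refl G (suc ℓ) u rewrite reach-refl G ℓ u = refl

module _ (E : List (Edge n)) (loopless : ∀ a → (a , a) ∉ E) where

  private G = edgeGraph E loopless

  ball⇒reach : ∀ ℓ {u v} → v ∈ ball E ℓ u → reach G ℓ u v ≡ true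
  ball⇒reach zero {u} (here refl) = reach-refl G 0 u
  ball⇒reach (suc ℓ) {u} (here refl) = reach-refl G (suc ℓ) u
  ball⇒reach (suc ℓ) {u} {v} (there p)
    with find (∈-concatMap⁻ (ball E ℓ) {nbrs E u} p)
  ... | w , w∈ , v∈ = trans (cong (reach G ℓ u v ∨_) (any-true⁺ _ (∈-allFin w)
          (cong₂ _∧_ (adj-uw (nbrs⁻ E u w∈)) (ball⇒reach ℓ v∈)))) (∨-zeroʳ _)
    where
    adj-uw : (u , w) ∈ E ⊎ (w , u) ∈ E → adj G u w ≡ true
    adj-uw (inj₁ q) rewrite ∈ᵇ⁺ _ E q = refl
    adj-uw (inj₂ q) rewrite ∈ᵇ⁺ _ E q = ∨-zeroʳ _

  joins⇒reach : ∀ ℓ {u v} Z → Over E Z → Joins u v Z → length Z ≤ ℓ → reach G ℓ u v ≡ true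
  joins⇒reach ℓ Z ov j len = ball⇒reach ℓ (joins⇒ball ℓ Z ov j len)

  reach⇒joins : ∀ ℓ {u v} → reach G ℓ u v ≡ true →
                ∃ λ Z → Over E Z × Joins u v Z × length Z ≤ ℓ
  reach⇒joins zero {u} {v} p with u ≟ v
  ... | yes refl = [] , [] , Joins-refl {a = u} , z≤n
  reach⇒joins (suc ℓ) {u} {v} p with ∨-true (reach G ℓ u v) _ p
  ... | inj₁ q = let Z , ov , j , len = reach⇒joins ℓ q in Z , ov , j , m≤n⇒m≤1+n len
  ... | inj₂ q with any-true⁻ _ (allFin n) q
  ...   | w , _ , q' with ∧-true (adj G u w) _ q'
  ...     | uw , r with reach⇒joins ℓ r | ∨-true ((u , w) ∈ᵇ E) _ uw
  ...       | Z , ov , j , len | inj₁ s = (u , w) ∷ Z , ∈ᵇ⁻ _ E s ∷ ov , Joins-∷ {Z = Z} {u} {w} {v} j , s≤s len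
  ...       | Z , ov , j , len | inj₂ s =
    (w , u) ∷ Z , ∈ᵇ⁻ _ E s ∷ ov ,
    (λ x → trans (cong (_xor ∂ Z x) (ends-sym w u x)) (Joins-∷ {Z = Z} {u} {w} {v} j x)) , s≤s len

  distSearch-≤ : ∀ {u v ℓ} → reach G ℓ u v ≡ true → ∀ fuel s → s ≤ ℓ → distSearch G u v fuel s ≤ ℓ
  distSearch-≤ r zero    s s≤ℓ = s≤ℓ
  distSearch-≤ {u} {v} {ℓ} r (suc fuel) s s≤ℓ with reach G s u v in eq
  ... | true  = s≤ℓ
  ... | false = distSearch-≤ r fuel (suc s) (≤∧≢⇒< s≤ℓ λ { refl → contradiction (trans (sym eq) r) λ() })

  distSearch-reach : ∀ u v fuel s → reach G (distSearch G u v fuel s) u v ≡ true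
                                  ⊎ distSearch G u v fuel s ≡ fuel + s
  distSearch-reach u v zero    s = inj₂ refl
  distSearch-reach u v (suc fuel) s with reach G s u v in eq
  ... | true  = inj₁ eq
  ... | false with distSearch-reach u v fuel (suc s)
  ...   | inj₁ p = inj₁ p
  ...   | inj₂ p = inj₂ (trans p (+-suc fuel s))

  joins⇒dist≤ : ∀ {u v} Z → Over E Z → Joins u v Z → dist G u v ≤ length Z
  joins⇒dist≤ Z ov j = distSearch-≤ (joins⇒reach (length Z) Z ov j ≤-refl) n 0 z≤n

  -- If the search runs out of fuel, `dist` has the value `n`, and the given chain is itself a
  -- witness.
  geodesic : ∀ {u v} → (∃ λ Z → Over E Z × Joins u v Z × length Z ≤ n) →
             ∃ λ Z → Over E Z × Joins u v Z × length Z ≤ dist G u v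
  geodesic {u} {v} (Z , ov , j , len) with distSearch-reach u v n 0
  ... | inj₁ r = reach⇒joins (dist G u v) r
  ... | inj₂ q = Z , ov , j , ≤-trans len (≤-reflexive (sym (trans q (+-identityʳ n))))

  dist-pos : ∀ {u v} → u ≢ v → 0 < n → 0 < dist G u v
  dist-pos {u} {v} u≢v 0<n with distSearch-reach u v n 0
  ... | inj₂ q = subst (0 <_) (sym (trans q (+-identityʳ n))) 0<n
  ... | inj₁ r with dist G u v
  ...   | suc _ = z<s
  ...   | zero with u ≟ v
  ...     | yes u≡v = contradiction u≡v u≢v

-- Adding an edge between distant vertices

-- Deletes all copies of `e`. Pairs of copies cancel mod 2, so the boundary changes by `ends e`
-- exactly when their number is odd; in that case at least one edge has gone.
cancel : ∀ (e : Edge n) Z → Over (e ∷ E) Z →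
         ∃ λ Z' → Over E Z' × (∀ f → f ≢ e → odd f Z ≡ odd f Z') ×
           ((odd e Z ≡ false × (∀ v → ∂ Z v ≡ ∂ Z' v) × length Z' ≤ length Z)
           ⊎ (odd e Z ≡ true × (∀ v → ∂ Z v ≡ ends e v xor ∂ Z' v) × length Z' < length Z))
cancel e [] [] = [] , [] , (λ _ _ → refl) , inj₁ (refl , (λ _ → refl) , z≤n)
cancel e (f ∷ Z) (f∈ ∷ ov) with f ≟ᵉ e | cancel e Z ov
... | yes refl | Z' , ov' , other , inj₁ (p , ∂eq , len) =
  Z' , ov' , (λ g g≢ → trans (cong (_xor odd g Z) (dec-false (f ≟ᵉ g) (g≢ ∘ sym))) (other g g≢)) ,
  inj₂ (cong not p , (λ v → cong (ends f v xor_) (∂eq v)) , s≤s len)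
... | yes refl | Z' , ov' , other , inj₂ (p , ∂eq , len) =
  Z' , ov' , (λ g g≢ → trans (cong (_xor odd g Z) (dec-false (f ≟ᵉ g) (g≢ ∘ sym))) (other g g≢)) ,
  inj₁ (cong not p , (λ v → trans (cong (ends f v xor_) (∂eq v)) (xor-cancelˡ (ends f v) _)) , m≤n⇒m≤1+n (<⇒≤ len))
cancel e (f ∷ Z) (here f≡e ∷ ov) | no f≢e | _ = contradiction f≡e f≢e
cancel e (f ∷ Z) (there f∈ ∷ ov) | no f≢e | Z' , ov' , other , inj₁ (p , ∂eq , len) =
  f ∷ Z' , f∈ ∷ ov' , (λ g g≢ → cong (does (f ≟ᵉ g) xor_) (other g g≢)) ,
  inj₁ (p , (λ v → cong (ends f v xor_) (∂eq v)) , s≤s len)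
cancel e (f ∷ Z) (there f∈ ∷ ov) | no f≢e | Z' , ov' , other , inj₂ (p , ∂eq , len) =
  f ∷ Z' , f∈ ∷ ov' , (λ g g≢ → cong (does (f ≟ᵉ g) xor_) (other g g≢)) ,
  inj₂ (p , (λ v → trans (cong (ends f v xor_) (∂eq v)) (xor-swap (ends f v) (ends e v) _)) , s≤s len)

-- If a short closed chain used the new edge an odd number of times, the rest of it would join `a`
-- to `b` with fewer than `g` edges. Otherwise the rest is closed and the old girth applies.
girth-∷ : ∀ {g} {a b : Fin n} → Girth E g → Separated E a b g → Girth ((a , b) ∷ E) g
girth-∷ {a = a} {b} girth sep Z ov closed len f with cancel (a , b) Z ov
... | Z' , ov' , other , inj₂ (_ , ∂eq , len') = contradiction
        (sep Z' ov' λ v → sym (xor≡false⇒≡ (ends (a , b) v) _ (trans (sym (∂eq v)) (closed v))))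
        (<⇒≱ (<-trans len' len))
... | Z' , ov' , other , inj₁ (p , ∂eq , len') with f ≟ᵉ (a , b)
...   | yes refl = p
...   | no f≢ = trans (other f f≢)
                  (girth Z' ov' (λ v → trans (sym (∂eq v)) (closed v)) (≤-<-trans len' len) f)

-- An odd use of the new edge leaves a shorter chain from `t` to `x`; an even use leaves one from
-- `t` to `y` in the old graph.
separated-∷ : ∀ {t x y : Fin n} {r} → Separated E t x r → Separated E t y (suc r) →
              Separated ((y , x) ∷ E) t y (suc r)
separated-∷ {t = t} {x} {y} sepx sepy Z ov j with cancel (y , x) Z ov
... | Z' , ov' , _ , inj₁ (_ , ∂eq , len) = ≤-trans (sepy Z' ov' λ v → trans (sym (∂eq v)) (j v)) len
... | Z' , ov' , _ , inj₂ (_ , ∂eq , len) = ≤-trans (s≤s (sepx Z' ov' λ v → begin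
    ∂ Z' v                                       ≡⟨ xor-cancelˡ (ends (y , x) v) _ ⟨
    ends (y , x) v xor (ends (y , x) v xor ∂ Z' v) ≡⟨ cong (ends (y , x) v xor_) (∂eq v) ⟨
    ends (y , x) v xor ∂ Z v                     ≡⟨ cong (ends (y , x) v xor_) (j v) ⟩
    ends (y , x) v xor ends (t , y) v            ≡⟨ xor-comm (ends (y , x) v) _ ⟩
    ends (t , y) v xor ends (y , x) v            ≡⟨ ends-trans t y x v ⟩
    ends (t , x) v                               ∎)) len
  where open ≡-Reasoning

separated⇒∉ : ∀ {a b : Fin n} {r} → 1 < r → Separated E a b r → (a , b) ∉ E
separated⇒∉ {a = a} {b} 1<r sep p = <⇒≱ 1<r (sep ((a , b) ∷ []) (p ∷ []) (Joins-edge {a = a} {b}))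

-- An edge of `R` occurs once there, hence an odd number of times in `A`. Dropping it from `R` and
-- one copy from `A` preserves evenness.
unique⇒length≤ : ∀ {R A : List (Edge n)} → Unique R → (∀ f → odd f (R ++ A) ≡ false) → length R ≤ length A
unique⇒length≤ {R = []} _ even = z≤n
unique⇒length≤ {R = e ∷ R} {A} (e∉ ∷ uniq) even with ∈-∃++ (odd⇒∈ e A e-odd)
  where
  e-odd : odd e A ≡ true
  e-odd = sym (xor≡false⇒≡ true (odd e A) (trans (sym (trans (odd-++ e (e ∷ R) A)
    (cong (_xor odd e A) (cong₂ _xor_ (dec-true (e ≟ᵉ e) refl)
      (odd-∉ e R (λ e∈ → All.lookup e∉ e∈ refl)))))) (even e)))
... | A₁ , A₂ , refl = begin
    suc (length R)             ≤⟨ s≤s (unique⇒length≤ uniq even') ⟩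
    suc (length (A₁ ++ A₂))    ≡⟨ cong suc (length-++ A₁) ⟩
    suc (length A₁ + length A₂) ≡⟨ +-suc (length A₁) _ ⟨
    length A₁ + length (e ∷ A₂) ≡⟨ length-++ A₁ ⟨
    length (A₁ ++ e ∷ A₂)      ∎
  where
  open ≤-Reasoning
  even' : ∀ f → odd f (R ++ A₁ ++ A₂) ≡ false
  even' f = trans (sym eq) (even f)
    where
    d = does (e ≟ᵉ f)
    eq : odd f ((e ∷ R) ++ A₁ ++ e ∷ A₂) ≡ odd f (R ++ A₁ ++ A₂)
    eq = trans (cong (d xor_) (trans (odd-++ f R _) (trans
      (cong (odd f R xor_) (trans (odd-++ f A₁ (e ∷ A₂)) (trans (xor-swap (odd f A₁) d (odd f A₂))
        (cong (d xor_) (sym (odd-++ f A₁ A₂))))))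
      (xor-swap (odd f R) d _)))) (trans (xor-cancelˡ d _) (sym (odd-++ f R (A₁ ++ A₂))))

-- The Hamiltonian cycle

toℕ-next-inject₁ : ∀ {m} (i : Fin m) → toℕ (next (inject₁ i)) ≡ suc (toℕ i)
toℕ-next-inject₁ {m} i = trans (toℕ-fromℕ< _)
  (trans (cong (λ k → suc k % suc m) (toℕ-inject₁ i)) (m<n⇒m%n≡m (s≤s (toℕ<n i))))

next-inject₁ : ∀ {m} (i : Fin m) → next (inject₁ i) ≡ suc i
next-inject₁ i = toℕ-injective (toℕ-next-inject₁ i)

next-fromℕ : ∀ m → next (fromℕ m) ≡ zero
next-fromℕ m = toℕ-injective (trans (toℕ-fromℕ< _)
  (trans (cong (λ k → suc k % suc m) (toℕ-fromℕ m)) (n%n≡0 (suc m))))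

prev : ∀ {m} → Fin (suc m) → Fin (suc m)
prev {m} zero = fromℕ m
prev (suc i)  = inject₁ i

next-prev : ∀ {m} (v : Fin (suc m)) → next (prev v) ≡ v
next-prev {m} zero = next-fromℕ m
next-prev (suc i)  = next-inject₁ i

prev-next : ∀ {m} (v : Fin (suc m)) → prev (next v) ≡ v
prev-next v with view v
... | ‵fromℕ {m} = cong prev (next-fromℕ m)
... | ‵inj₁ {i = i} _ = cong prev (next-inject₁ i)

next-injective : ∀ {m} {u v : Fin (suc m)} → next u ≡ next v → u ≡ v
next-injective {u = u} {v} eq = trans (sym (prev-next u)) (trans (cong prev eq) (prev-next v))

toℕ-next : ∀ {m} (v : Fin (suc m)) → toℕ (next v) ≡ suc (toℕ v) ⊎ (toℕ v ≡ m × toℕ (next v) ≡ 0)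
toℕ-next v with view v
... | ‵fromℕ {m} = inj₂ (toℕ-fromℕ m , cong toℕ (next-fromℕ m))
... | ‵inj₁ {i = i} _ = inj₁ (trans (toℕ-next-inject₁ i) (cong suc (sym (toℕ-inject₁ i))))

next≢ : ∀ {m} → 0 < m → (v : Fin (suc m)) → next v ≢ v
next≢ 0<m v eq with toℕ-next v
... | inj₁ p       = 1+n≢n (trans (sym p) (cong toℕ eq))
... | inj₂ (p , q) = <⇒≢ 0<m (trans (sym q) (trans (cong toℕ eq) p))

next-next≢ : ∀ {m} → 1 < m → (v : Fin (suc m)) → next (next v) ≢ v
next-next≢ 1<m v eq with toℕ-next v | toℕ-next (next v) | cong toℕ eq
... | inj₁ p       | inj₁ q       | r = m+1+n≢n 1 (trans (cong suc (sym p)) (trans (sym q) r))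
... | inj₁ p       | inj₂ (q , s) | r = <⇒≢ 1<m (trans (cong suc (trans (sym s) r)) (trans (sym p) q))
... | inj₂ (p , q) | inj₁ s       | r = <⇒≢ 1<m (trans (cong suc (sym q)) (trans (sym s) (trans r p)))
... | inj₂ (p , q) | inj₂ (s , _) | r = <⇒≢ (<⇒≤ 1<m) (trans (sym q) s)

cycleEdge : ∀ {m} → Fin (suc m) → Edge (suc m)
cycleEdge i = i , next i

cycle : ∀ m → List (Edge (suc m))
cycle m = map cycleEdge (allFin (suc m))

cycleEdge∈ : ∀ {m} (i : Fin (suc m)) → cycleEdge i ∈ cycle m
cycleEdge∈ i = ∈-map⁺ cycleEdge (∈-allFin i)

cycle-unique : ∀ m → Unique (cycle m)
cycle-unique m = Unique.map⁺ (cong proj₁) (Unique.allFin⁺ (suc m))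

length-cycle : ∀ m → length (cycle m) ≡ suc m
length-cycle m = trans (length-map cycleEdge (allFin (suc m))) (length-tabulate (λ i → i))

∂-cycle : ∀ {m} (i : Fin (suc m)) Z → Over (cycle m) Z →
          ∂ Z (next i) ≡ odd (cycleEdge i) Z xor odd (cycleEdge (next i)) Z
∂-cycle i [] [] = refl
∂-cycle {m} i (e ∷ Z) (e∈ ∷ ov) with ∈-map⁻ cycleEdge e∈
... | j , _ , refl = begin
    (δ j (next i) xor δ (next j) (next i)) xor ∂ Z (next i)
      ≡⟨ cong₂ _xor_ (cong₂ _xor_ (same j (next i)) δ-next) (∂-cycle i Z ov) ⟩
    (a xor b) xor (c xor d)   ≡⟨ cong (_xor (c xor d)) (xor-comm a b) ⟩
    (b xor a) xor (c xor d)   ≡⟨ xor-assoc b a _ ⟩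
    b xor (a xor (c xor d))   ≡⟨ cong (b xor_) (xor-swap a c d) ⟩
    b xor (c xor (a xor d))   ≡⟨ xor-assoc b c _ ⟨
    (b xor c) xor (a xor d)   ∎
  where
  open ≡-Reasoning
  a = does (cycleEdge j ≟ᵉ cycleEdge (next i))
  b = does (cycleEdge j ≟ᵉ cycleEdge i)
  c = odd (cycleEdge i) Z
  d = odd (cycleEdge (next i)) Z
  same : ∀ (j k : Fin (suc m)) → δ j k ≡ does (cycleEdge j ≟ᵉ cycleEdge k)
  same j k = does-⇔ (mk⇔ (cong cycleEdge) (cong proj₁)) (j ≟ k) (cycleEdge j ≟ᵉ cycleEdge k)
  δ-next : δ (next j) (next i) ≡ b
  δ-next = trans (does-⇔ (mk⇔ next-injective (cong next)) (next j ≟ next i) (j ≟ i)) (same j i)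

-- By `∂-cycle`, closedness makes consecutive cycle edges equally often used mod 2. If all of them
-- were odd, the chain would be at least as long as the cycle.
cycle-girth : ∀ m → Girth (cycle m) (suc m)
cycle-girth m Z ov closed len = all-even
  where
  c : Fin (suc m) → Bool
  c i = odd (cycleEdge i) Z
  c-next : ∀ i → c i ≡ c (next i)
  c-next i = xor≡false⇒≡ (c i) (c (next i)) (trans (sym (∂-cycle i Z ov)) (closed (next i)))
  constant : ∀ i → c i ≡ c zero
  constant = <-weakInduction (λ i → c i ≡ c zero) refl
    λ i eq → trans (cong c (sym (next-inject₁ i))) (trans (sym (c-next (inject₁ i))) eq)
  not-full : c zero ≢ true
  not-full all-odd = <⇒≱ len (subst (_≤ length Z) (length-cycle m) (unique⇒length≤ (cycle-unique m) even))
    where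
    odd-cycle : ∀ xs → Unique xs → ∀ i → i ∈ xs → odd (cycleEdge i) (map cycleEdge xs) ≡ true
    odd-cycle (x ∷ xs) (x∉ ∷ u) i (here refl) = cong₂ _xor_ (dec-true (cycleEdge i ≟ᵉ cycleEdge i) refl)
      (odd-∉ _ _ λ i∈ → let j , j∈ , eq = ∈-map⁻ cycleEdge i∈ in All.lookup x∉ j∈ (cong proj₁ eq))
    odd-cycle (x ∷ xs) (x∉ ∷ u) i (there i∈) = cong₂ _xor_
      (dec-false (cycleEdge x ≟ᵉ cycleEdge i) (All.lookup x∉ i∈ ∘ cong proj₁)) (odd-cycle xs u i i∈)
    even : ∀ f → odd f (cycle m ++ Z) ≡ false
    even f with f ∈? cycle m
      where open DecMembership _≟ᵉ_ using (_∈?_)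
    ... | no f∉ = trans (odd-++ f (cycle m) Z) (cong₂ _xor_ (odd-∉ f (cycle m) f∉)
                    (odd-∉ f Z λ f∈ → f∉ (All.lookup ov f∈)))
    ... | yes f∈ with ∈-map⁻ cycleEdge f∈
    ...   | i , i∈ , refl = trans (odd-++ (cycleEdge i) (cycle m) Z)
            (cong₂ _xor_ (odd-cycle _ (Unique.allFin⁺ (suc m)) i i∈) (trans (constant i) all-odd))
  all-even : ∀ f → odd f Z ≡ false
  all-even f with odd f Z in eq
  ... | false = refl
  ... | true with ∈-map⁻ cycleEdge (All.lookup ov (odd⇒∈ f Z eq))
  ...   | i , _ , refl = contradiction (trans (sym (constant i)) eq) not-full

cycle-arc : ∀ {m} (v u : Fin (suc m)) → toℕ u ≤ toℕ v →
            ∃ λ Z → Over (cycle m) Z × Joins u v Z × length Z ≤ toℕ v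
cycle-arc {m} = <-weakInduction P
  (λ { zero _ → [] , [] , Joins-refl {a = zero} , z≤n }) step
  where
  P : Fin (suc m) → Set
  P v = ∀ u → toℕ u ≤ toℕ v → ∃ λ Z → Over (cycle m) Z × Joins u v Z × length Z ≤ toℕ v
  step : ∀ i → P (inject₁ i) → P (suc i)
  step i ih u u≤ with m≤n⇒m<n∨m≡n u≤
  ... | inj₂ eq rewrite toℕ-injective eq = [] , [] , Joins-refl {a = suc i} , z≤n
  ... | inj₁ lt with ih u (subst (toℕ u ≤_) (sym (toℕ-inject₁ i)) (s≤s⁻¹ lt))
  ...   | Z , ov , j , len =
    Z ++ e ∷ [] , All.++⁺ ov (e∈ ∷ []) ,
    Joins-++ {Z = Z} {e ∷ []} {u} {inject₁ i} {suc i} j (Joins-edge {a = inject₁ i} {suc i}) ,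
    subst (_≤ suc (toℕ i)) (sym (trans (length-++ Z) (+-comm (length Z) 1)))
      (s≤s (subst (length Z ≤_) (toℕ-inject₁ i) len))
    where
    e = inject₁ i , suc i
    e∈ : e ∈ cycle m
    e∈ = subst (λ w → (inject₁ i , w) ∈ cycle m) (next-inject₁ i) (cycleEdge∈ (inject₁ i))

cycle-connects : ∀ {m} (u v : Fin (suc m)) → ∃ λ Z → Over (cycle m) Z × Joins u v Z × length Z ≤ suc m
cycle-connects u v with ≤-total (toℕ u) (toℕ v)
... | inj₁ u≤v = let Z , ov , j , len = cycle-arc v u u≤v in
                 Z , ov , j , ≤-trans len (<⇒≤ (toℕ<n v))
... | inj₂ v≤u = let Z , ov , j , len = cycle-arc u v v≤u in
                 Z , ov , Joins-sym {Z = Z} {v} {u} j , ≤-trans len (<⇒≤ (toℕ<n u))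

-- Exchanging tour edges

unique-⊆ : ∀ {A : Set} {xs ys : List A} → xs ⊆ ys → Unique ys → Unique xs
unique-⊆ []         []       = []
unique-⊆ (y ∷ʳ s)   (_ ∷ u)  = unique-⊆ s u
unique-⊆ (refl ∷ s) (y∉ ∷ u) = All-resp-⊆ s y∉ ∷ unique-⊆ s u

module ∑-Indicator (M : CommutativeMonoid 0ℓ 0ℓ) where
  open CommutativeMonoid M renaming (refl to ≈-refl; sym to ≈-sym; trans to ≈-trans)
  open CMSum M

  ∑-empty : ∀ {n} (p : Fin n → Bool) (c : Carrier) → (∀ i → p i ≡ false) →
            sum (λ i → if p i then c else ε) ≈ ε
  ∑-empty {n} p c none = ≈-trans
    (sum-cong-≋ {n} {λ i → if p i then c else ε} {λ _ → ε}
      (λ i → reflexive (cong (λ b → if b then c else ε) (none i))))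
    (sum-replicate-zero n)

  -- Turns the Boolean search in `inTour` into a sum, so that orders of summation can be exchanged.
  ∑-indicator : ∀ {A : Set} {n} (p : A → Bool) (g : Fin n → A) (c : Carrier) →
                (∀ i j → p (g i) ≡ true → p (g j) ≡ true → i ≡ j) →
                sum (λ i → if p (g i) then c else ε) ≈ (if any p (tabulate g) then c else ε)
  ∑-indicator {n = zero} p g c once = ≈-refl
  ∑-indicator {n = suc n} p g c once with p (g zero) in eq
  ... | true  = ≈-trans (∙-cong ≈-refl (∑-empty (p ∘ g ∘ suc) c none)) (identityʳ c)
    where
    none : ∀ i → p (g (suc i)) ≡ false
    none i with p (g (suc i)) in eq'
    ... | false = refl
    ... | true  = contradiction (once zero (suc i) eq eq') λ()
  ... | false = ≈-trans (identityˡ _)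
    (∑-indicator p (g ∘ suc) c λ i j pi pj → suc-inj (once (suc i) (suc j) pi pj))
    where
    suc-inj : ∀ {i j : Fin n} → Fin.suc i ≡ suc j → i ≡ j
    suc-inj refl = refl

sameEdge : (a b c d : Fin n) → Bool
sameEdge a b c d = (⌊ a ≟ c ⌋ ∧ ⌊ b ≟ d ⌋) ∨ (⌊ a ≟ d ⌋ ∧ ⌊ b ≟ c ⌋)

sameEdge⁻ : ∀ (a b c d : Fin n) → sameEdge a b c d ≡ true → (a ≡ c × b ≡ d) ⊎ (a ≡ d × b ≡ c)
sameEdge⁻ a b c d p with a ≟ c | b ≟ d | a ≟ d | b ≟ c
... | yes q | yes r | _     | _     = inj₁ (q , r)
... | _     | _     | yes q | yes r = inj₂ (q , r)
sameEdge⁻ a b c d () | yes _ | no _  | yes _ | no _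
sameEdge⁻ a b c d () | yes _ | no _  | no _  | _
sameEdge⁻ a b c d () | no _  | _     | yes _ | no _
sameEdge⁻ a b c d () | no _  | _     | no _  | _

≟-refl : ∀ (a : Fin n) → ⌊ a ≟ a ⌋ ≡ true
≟-refl a with a ≟ a
... | yes _ = refl
... | no ¬p = contradiction refl ¬p

sameEdge⁺ : ∀ (a b c d : Fin n) → (a ≡ c × b ≡ d) ⊎ (a ≡ d × b ≡ c) → sameEdge a b c d ≡ true
sameEdge⁺ a b a b (inj₁ (refl , refl)) rewrite ≟-refl a | ≟-refl b = refl
sameEdge⁺ a b b a (inj₂ (refl , refl)) rewrite ≟-refl a | ≟-refl b = ∨-zeroʳ _

sameEdge-comm : ∀ (a b c d : Fin n) → sameEdge a b c d ≡ sameEdge c d a b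
sameEdge-comm a b c d = ⇔→≡ (mk⇔ (λ p → sameEdge⁺ c d a b (flip (sameEdge⁻ a b c d p)))
                                 (λ p → sameEdge⁺ a b c d (flip (sameEdge⁻ c d a b p))))
  where
  flip : ∀ {a b c d : Fin n} → (a ≡ c × b ≡ d) ⊎ (a ≡ d × b ≡ c) → (c ≡ a × d ≡ b) ⊎ (c ≡ b × d ≡ a)
  flip (inj₁ (p , q)) = inj₁ (sym p , sym q)
  flip (inj₂ (p , q)) = inj₂ (sym q , sym p)

nextₚ : ∀ {m} → Permutation′ (suc m)
nextₚ = permutation next prev next-prev prev-next

tour-injective : ∀ {m} (π : Tour m) {i j} → π ⟨$⟩ʳ i ≡ π ⟨$⟩ʳ j → i ≡ j
tour-injective π eq = trans (sym (inverseˡ π)) (trans (cong (π ⟨$⟩ˡ_) eq) (inverseˡ π))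

common : ∀ {m} → Tour m → Tour m → Fin (suc m) → Bool
common π π' i = inTour π' (edgeFst π i) (edgeSnd π i)

-- A tour on at least three vertices uses no edge twice, so an edge of one tour
-- matches at most one edge of the other.
match-once : ∀ {m} → 1 < m → (π : Tour m) (a b : Fin (suc m)) → ∀ i j →
             sameEdge a b (edgeFst π i) (edgeSnd π i) ≡ true →
             sameEdge a b (edgeFst π j) (edgeSnd π j) ≡ true → i ≡ j
match-once 1<m π a b i j p q with sameEdge⁻ a b _ _ p | sameEdge⁻ a b _ _ q
... | inj₁ (r , _) | inj₁ (s , _) = tour-injective π (trans (sym r) s)
... | inj₂ (_ , r) | inj₂ (_ , s) = tour-injective π (trans (sym r) s)
... | inj₁ (r , t) | inj₂ (s , u) = contradiction
        (trans (cong next (tour-injective π (trans (sym t) u))) (tour-injective π (trans (sym s) r))) (next-next≢ 1<m i)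
... | inj₂ (s , u) | inj₁ (r , t) = contradiction
        (trans (cong next (tour-injective π (trans (sym s) r))) (tour-injective π (trans (sym t) u))) (next-next≢ 1<m i)

-- Generic in the monoid because it serves twice: in ℕ with distances, for costs, and in `Bool`
-- under xor with `ends`, for boundaries.
module Exchange (M : CommutativeMonoid 0ℓ 0ℓ) {m : ℕ} (1<m : 1 < m)
  (f : Fin (suc m) → Fin (suc m) → CommutativeMonoid.Carrier M)
  (f-comm : ∀ a b → CommutativeMonoid._≈_ M (f a b) (f b a)) where

  open CommutativeMonoid M renaming (refl to ≈-refl; sym to ≈-sym; trans to ≈-trans)
  open CMSum M
  open ∑-Indicator M

  weight : Tour m → Fin (suc m) → Carrier
  weight π i = f (edgeFst π i) (edgeSnd π i)

  matches : Tour m → Tour m → Fin (suc m) → Fin (suc m) → Bool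
  matches π π' i j = sameEdge (edgeFst π i) (edgeSnd π i) (edgeFst π' j) (edgeSnd π' j)

  -- Double counting of the pairs of positions that carry the same edge; the symmetry of `f` covers
  -- edges traversed in opposite directions.
  ∑-common : ∀ π π' → sum (λ i → if common π π' i then weight π i else ε)
                    ≈ sum (λ j → if common π' π j then weight π' j else ε)
  ∑-common π π' = begin
    sum (λ i → if common π π' i then weight π i else ε)
      ≈⟨ sum-cong-≋ (λ i → ∑-indicator (matches π π' i) (λ j → j) (weight π i) (match-once 1<m π' (edgeFst π i) (edgeSnd π i))) ⟨
    sum (λ i → sum (λ j → if matches π π' i j then weight π i else ε))
      ≈⟨ sum-cong-≋ (λ i → sum-cong-≋ (λ j → swap i j)) ⟩
    sum (λ i → sum (λ j → if matches π' π j i then weight π' j else ε))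
      ≈⟨ ∑-comm (λ i j → if matches π' π j i then weight π' j else ε) ⟩
    sum (λ j → sum (λ i → if matches π' π j i then weight π' j else ε))
      ≈⟨ sum-cong-≋ (λ j → ∑-indicator (matches π' π j) (λ i → i) (weight π' j) (match-once 1<m π (edgeFst π' j) (edgeSnd π' j))) ⟩
    sum (λ j → if common π' π j then weight π' j else ε) ∎
    where
    open import Relation.Binary.Reasoning.Setoid (CommutativeMonoid.setoid M)
    swap : ∀ i j → (if matches π π' i j then weight π i else ε) ≈ (if matches π' π j i then weight π' j else ε)
    swap i j rewrite sameEdge-comm (edgeFst π' j) (edgeSnd π' j) (edgeFst π i) (edgeSnd π i)
      with matches π π' i j in eq
    ... | false = ≈-refl
    ... | true with sameEdge⁻ (edgeFst π i) (edgeSnd π i) _ _ eq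
    ...   | inj₁ (p , q) = reflexive (cong₂ f p q)
    ...   | inj₂ (p , q) = ≈-trans (reflexive (cong₂ f p q)) (f-comm _ _)

  ∑-split : ∀ (b : Fin (suc m) → Bool) (w : Fin (suc m) → Carrier) →
            sum w ≈ sum (λ i → if b i then w i else ε) ∙ sum (λ i → if b i then ε else w i)
  ∑-split b w = ≈-trans (sum-cong-≋ split) (∑-distrib-+ (λ i → if b i then w i else ε) (λ i → if b i then ε else w i))
    where
    split : ∀ i → w i ≈ (if b i then w i else ε) ∙ (if b i then ε else w i)
    split i with b i
    ... | true  = ≈-sym (identityʳ _)
    ... | false = ≈-sym (identityˡ _)

-- Sums over tour positions and concatenated families of chains

module ℕ∑ = CMSum +-0-commutativeMonoid
module 𝔹∑ = CMSum (CommutativeRing.+-commutativeMonoid xor-∧-commutativeRing)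

sumᴸ-allFin : ∀ {k} (f : Fin k → ℕ) → sumᴸ (map f (allFin k)) ≡ ℕ∑.sum f
sumᴸ-allFin {k} f = trans (cong sumᴸ (map-tabulate (λ i → i) f)) (go f)
  where
  go : ∀ {k} (f : Fin k → ℕ) → sumᴸ (tabulate f) ≡ ℕ∑.sum f
  go {zero}  f = refl
  go {suc k} f = cong (f zero +_) (go (f ∘ suc))

∑-mono-≤ : ∀ {k} {f g : Fin k → ℕ} → (∀ i → f i ≤ g i) → ℕ∑.sum f ≤ ℕ∑.sum g
∑-mono-≤ {zero}  h = z≤n
∑-mono-≤ {suc k} h = +-mono-≤ (h zero) (∑-mono-≤ (h ∘ suc))

∑-*-distribˡ : ∀ {k} c (f : Fin k → ℕ) → ℕ∑.sum (λ i → c * f i) ≡ c * ℕ∑.sum f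
∑-*-distribˡ {zero}  c f = sym (*-zeroʳ c)
∑-*-distribˡ {suc k} c f = trans (cong (c * f zero +_) (∑-*-distribˡ c (f ∘ suc))) (sym (*-distribˡ-+ c (f zero) _))

concatTab : ∀ {A : Set} {k} → (Fin k → List A) → List A
concatTab {k = zero}  Q = []
concatTab {k = suc k} Q = Q zero ++ concatTab (Q ∘ suc)

∂-concatTab : ∀ {k} (Q : Fin k → List (Edge n)) v → ∂ (concatTab Q) v ≡ 𝔹∑.sum (λ i → ∂ (Q i) v)
∂-concatTab {k = zero}  Q v = refl
∂-concatTab {k = suc k} Q v = trans (∂-++ (Q zero) _ v) (cong (∂ (Q zero) v xor_) (∂-concatTab (Q ∘ suc) v))

length-concatTab : ∀ {A : Set} {k} (Q : Fin k → List A) → length (concatTab Q) ≡ ℕ∑.sum (λ i → length (Q i))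
length-concatTab {k = zero}  Q = refl
length-concatTab {k = suc k} Q = trans (length-++ (Q zero)) (cong (length (Q zero) +_) (length-concatTab (Q ∘ suc)))

all-concatTab : ∀ {A : Set} {P : A → Set} {k} (Q : Fin k → List A) → (∀ i → All P (Q i)) → All P (concatTab Q)
all-concatTab {k = zero}  Q h = []
all-concatTab {k = suc k} Q h = All.++⁺ (h zero) (all-concatTab (Q ∘ suc) (h ∘ suc))

concatTab-⊆ : ∀ {A : Set} {k} {Q Q' : Fin k → List A} → (∀ i → Q i ⊆ Q' i) → concatTab Q ⊆ concatTab Q'
concatTab-⊆ {k = zero}  h = []
concatTab-⊆ {k = suc k} h = ++⁺ (h zero) (concatTab-⊆ (h ∘ suc))

⊆-concatTab : ∀ {A : Set} {k} (Q : Fin k → List A) i → Q i ⊆ concatTab Q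
⊆-concatTab Q zero    = subst (_⊆ concatTab Q) (++-identityʳ (Q zero)) (++⁺ ⊆-refl (minimum _))
⊆-concatTab Q (suc i) = ++⁺ (minimum (Q zero)) (⊆-concatTab (Q ∘ suc) i)

-- First ends and second ends run through the same vertices, shifted by `next`, so the two sums
-- cancel.
∑-tour-ends : ∀ {m} (π : Tour m) v → 𝔹∑.sum (λ i → ends (edgeFst π i , edgeSnd π i) v) ≡ false
∑-tour-ends {m} π v = trans (𝔹∑.∑-distrib-+ d (d ∘ next))
  (trans (cong (𝔹∑.sum d xor_) (sym (𝔹∑.sum-permute d nextₚ))) (xor-same (𝔹∑.sum d)))
  where
  d : Fin (suc m) → Bool
  d i = δ (edgeFst π i) v

-- k-optimality of a tour shadowed by short edge-disjoint trails

module _ {m} {E : List (Edge (suc m))} {g L : ℕ} (1<m : 1 < m) (girth : Girth E g)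
  (loopless : ∀ a → (a , a) ∉ E)
  (connect : ∀ u v → ∃ λ Z → Over E Z × Joins u v Z × length Z ≤ suc m)
  (π : Tour m) (trail : Fin (suc m) → List (Edge (suc m)))
  (trail-over : ∀ i → Over E (trail i))
  (trail-joins : ∀ i → Joins (edgeFst π i) (edgeSnd π i) (trail i))
  (trail-short : ∀ i → length (trail i) ≤ L)
  (trails-unique : Unique (concatTab trail)) where

  private
    G = edgeGraph E loopless
    geo : ∀ u v → ∃ λ Z → Over E Z × Joins u v Z × length Z ≤ dist G u v
    geo u v = geodesic E loopless (connect u v)

  dist-sym : ∀ u v → dist G u v ≡ dist G v u
  dist-sym u v = ≤-antisym (le u v) (le v u)
    where
    le : ∀ u v → dist G u v ≤ dist G v u
    le u v = let Z , ov , j , len = geo v u in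
      ≤-trans (joins⇒dist≤ E loopless Z ov (Joins-sym {Z = Z} {v} {u} j)) len

  -- Trails are geodesics: a shorter chain would close up with the trail to fewer than `2L` edges,
  -- so it would have to contain every edge of the trail.
  trail≤dist : L + L ≤ g → ∀ i → length (trail i) ≤ dist G (edgeFst π i) (edgeSnd π i)
  trail≤dist 2L≤g i with geo (edgeFst π i) (edgeSnd π i)
  ... | W , ovW , jW , lenW = ≤-trans (≮⇒≥ longer) lenW
    where
    longer : length W ≮ length (trail i)
    longer lt = <⇒≱ lt (unique⇒length≤ (unique-⊆ (⊆-concatTab trail i) trails-unique)
      (girth (trail i ++ W) (All.++⁺ (trail-over i) ovW)
        (same-ends⇒closed {Z = trail i} {W} {edgeFst π i} {edgeSnd π i} (trail-joins i) jW)
        (subst (_< g) (sym (length-++ (trail i)))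
          (<-≤-trans (+-monoʳ-< (length (trail i)) lt) (≤-trans (+-mono-≤ (trail-short i) (trail-short i)) 2L≤g)))))

  trails≤cost : L + L ≤ g → length (concatTab trail) ≤ cost G π
  trails≤cost 2L≤g = subst₂ _≤_ (sym (length-concatTab trail)) (sym (sumᴸ-allFin (λ i → dist G (edgeFst π i) (edgeSnd π i))))
    (∑-mono-≤ (trail≤dist 2L≤g))

  module _ (π' : Tour m) where
    private
      d : Fin (suc m) → Fin (suc m) → ℕ
      d = dist G
      walk : Fin (suc m) → List (Edge (suc m))
      walk j = proj₁ (geo (edgeFst π' j) (edgeSnd π' j))
      b b' : Fin (suc m) → Bool
      b  = common π π'
      b' = common π' π
      Rs As : Fin (suc m) → List (Edge (suc m))
      Rs i = if b i then [] else trail i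
      As j = if b' j then [] else walk j
      R A : List (Edge (suc m))
      R = concatTab Rs
      A = concatTab As
      module ℕX = Exchange +-0-commutativeMonoid 1<m d dist-sym

      -- A whole tour has boundary zero, so the boundaries of `R` and of `A` both equal that of the
      -- common edges.
      ∂R≡∂A : ∀ v → ∂ R v ≡ ∂ A v
      ∂R≡∂A v = begin
        ∂ R v ≡⟨ ∂-concatTab Rs v ⟩
        𝔹∑.sum (λ i → ∂ (Rs i) v) ≡⟨ 𝔹∑.sum-cong-≗ ∂Rs ⟩
        𝔹∑.sum (λ i → if b i then false else X.weight π i) ≡⟨ other π b ⟨
        𝔹∑.sum (λ i → if b i then X.weight π i else false) ≡⟨ X.∑-common π π' ⟩
        𝔹∑.sum (λ i → if b' i then X.weight π' i else false) ≡⟨ other π' b' ⟩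
        𝔹∑.sum (λ i → if b' i then false else X.weight π' i) ≡⟨ 𝔹∑.sum-cong-≗ ∂As ⟨
        𝔹∑.sum (λ i → ∂ (As i) v) ≡⟨ ∂-concatTab As v ⟨
        ∂ A v ∎
        where
        open ≡-Reasoning
        module X = Exchange (CommutativeRing.+-commutativeMonoid xor-∧-commutativeRing) 1<m
          (λ a b → ends (a , b) v) (λ a b → ends-sym a b v)
        other : ∀ ρ (c : Fin (suc m) → Bool) → 𝔹∑.sum (λ i → if c i then X.weight ρ i else false)
                                             ≡ 𝔹∑.sum (λ i → if c i then false else X.weight ρ i)
        other ρ c = xor≡false⇒≡ _ _ (trans (sym (X.∑-split c (X.weight ρ))) (∑-tour-ends ρ v))
        ∂Rs : ∀ i → ∂ (Rs i) v ≡ (if b i then false else X.weight π i)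
        ∂Rs i with b i
        ... | true  = refl
        ... | false = trail-joins i v
        ∂As : ∀ i → ∂ (As i) v ≡ (if b' i then false else X.weight π' i)
        ∂As i with b' i
        ... | true  = refl
        ... | false = proj₁ (proj₂ (proj₂ (geo (edgeFst π' i) (edgeSnd π' i)))) v

      R-over : Over E R
      R-over = all-concatTab Rs go
        where
        go : ∀ i → Over E (Rs i)
        go i with b i
        ... | true  = []
        ... | false = trail-over i

      A-over : Over E A
      A-over = all-concatTab As go
        where
        go : ∀ i → Over E (As i)
        go i with b' i
        ... | true  = []
        ... | false = proj₁ (proj₂ (geo (edgeFst π' i) (edgeSnd π' i)))

      R-unique : Unique R
      R-unique = unique-⊆ (concatTab-⊆ go) trails-unique
        where
        go : ∀ i → Rs i ⊆ trail i
        go i with b i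
        ... | true  = minimum _
        ... | false = ⊆-refl

      S Rd Ad : ℕ
      S  = ℕ∑.sum (λ i → if b i then ℕX.weight π i else 0)
      Rd = ℕ∑.sum (λ i → if b i then 0 else ℕX.weight π i)
      Ad = ℕ∑.sum (λ i → if b' i then 0 else ℕX.weight π' i)

      cost-π : cost G π ≡ S + Rd
      cost-π = trans (sumᴸ-allFin (ℕX.weight π)) (ℕX.∑-split b (ℕX.weight π))

      cost-π' : cost G π' ≡ S + Ad
      cost-π' = trans (sumᴸ-allFin (ℕX.weight π')) (trans (ℕX.∑-split b' (ℕX.weight π'))
        (cong (_+ Ad) (sym (ℕX.∑-common π π'))))

      Rd≤R : Rd ≤ length R
      Rd≤R = subst (Rd ≤_) (sym (length-concatTab Rs)) (∑-mono-≤ go)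
        where
        go : ∀ i → (if b i then 0 else ℕX.weight π i) ≤ length (Rs i)
        go i with b i
        ... | true  = z≤n
        ... | false = joins⇒dist≤ E loopless (trail i) (trail-over i) (trail-joins i)

      A≤Ad : length A ≤ Ad
      A≤Ad = subst (_≤ Ad) (sym (length-concatTab As)) (∑-mono-≤ go)
        where
        go : ∀ i → length (As i) ≤ (if b' i then 0 else ℕX.weight π' i)
        go i with b' i
        ... | true  = z≤n
        ... | false = proj₂ (proj₂ (proj₂ (geo (edgeFst π' i) (edgeSnd π' i))))

      R≤ : length R ≤ L * removed π π'
      R≤ = subst₂ _≤_ (sym (length-concatTab Rs))
        (trans (∑-*-distribˡ L (λ i → if b i then 0 else 1)) (cong (L *_) (sym (sumᴸ-allFin (λ i → if b i then 0 else 1)))))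
        (∑-mono-≤ go)
        where
        go : ∀ i → length (Rs i) ≤ L * (if b i then 0 else 1)
        go i with b i
        ... | true  = z≤n
        ... | false = subst (_ ≤_) (sym (*-identityʳ L)) (trail-short i)

    kmove-not-shorter : ∀ {k} → L * k + L * k ≤ g → KMove k π π' → cost G π ≤ cost G π'
    kmove-not-shorter {k} 2Lk≤g move = ≮⇒≥ λ lt →
      let Ad<Rd : Ad < Rd
          Ad<Rd = +-cancelˡ-< S Ad Rd (subst₂ _<_ cost-π' cost-π lt)
          R≤Lk  = ≤-trans R≤ (*-monoʳ-≤ L move)
          -- The assumed improvement bounds the added geodesics by the removed trails, which brings
          -- `R ++ A` below the girth.
          A<Lk  = ≤-<-trans A≤Ad (<-≤-trans Ad<Rd (≤-trans Rd≤R R≤Lk))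
          R≤A   = unique⇒length≤ R-unique (girth (R ++ A) (All.++⁺ R-over A-over)
                    (λ v → trans (∂-++ R A v) (trans (cong (_xor ∂ A v) (∂R≡∂A v)) (xor-same (∂ A v))))
                    (subst (_< g) (sym (length-++ R)) (<-≤-trans (+-mono-≤-< R≤Lk A<Lk) 2Lk≤g)))
      in <⇒≱ Ad<Rd (≤-trans Rd≤R (≤-trans R≤A A≤Ad))

-- Greedy construction of the long trails

ι : Bool → ℕ
ι b = if b then 1 else 0

occ : Fin n → List (Fin n) → ℕ
occ v []       = 0
occ v (x ∷ xs) = ι (δ x v) + occ v xs

∈⇒occ>0 : ∀ {v : Fin n} {xs} → v ∈ xs → 0 < occ v xs
∈⇒occ>0 {v = v} (here refl) rewrite dec-true (v ≟ v) refl = z<s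
∈⇒occ>0 {xs = x ∷ _} (there v∈) = ≤-trans (∈⇒occ>0 v∈) (m≤n+m _ (ι (δ x _)))

∉⇒occ≡0 : ∀ {v : Fin n} xs → v ∉ xs → occ v xs ≡ 0
∉⇒occ≡0 []       v∉ = refl
∉⇒occ≡0 {v = v} (x ∷ xs) v∉ rewrite dec-false (x ≟ v) (λ { refl → v∉ (here refl) }) = ∉⇒occ≡0 xs (v∉ ∘ there)

unique⇒occ≤1 : ∀ (v : Fin n) xs → Unique xs → occ v xs ≤ 1
unique⇒occ≤1 v []       _        = z≤n
unique⇒occ≤1 v (x ∷ xs) (x∉ ∷ u) with x ≟ v
... | yes refl = s≤s (≤-reflexive (∉⇒occ≡0 xs λ v∈ → All.lookup x∉ v∈ refl))
... | no _     = unique⇒occ≤1 v xs u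

∑-δ : ∀ (x : Fin n) → ℕ∑.sum (λ v → ι (δ x v)) ≡ 1
∑-δ {suc n} zero    = cong suc (ℕ∑.sum-replicate-zero n)
∑-δ {suc n} (suc x) = ∑-δ x

∑-occ : ∀ (xs : List (Fin n)) → ℕ∑.sum (λ v → occ v xs) ≡ length xs
∑-occ {n} []   = ℕ∑.sum-replicate-zero n
∑-occ (x ∷ xs) = trans (ℕ∑.∑-distrib-+ (λ v → ι (δ x v)) (λ v → occ v xs)) (cong₂ _+_ (∑-δ x) (∑-occ xs))

deg-∷ : ∀ (a b : Fin n) E v → deg ((a , b) ∷ E) v ≡ ι (δ a v) + (ι (δ b v) + deg E v)
deg-∷ a b E v with δ a v | δ b v
... | true  | true  = refl
... | true  | false = refl
... | false | true  = refl
... | false | false = refl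

∑-deg : ∀ (E : List (Edge n)) → ℕ∑.sum (deg E) ≡ 2 * length E
∑-deg {n} [] = ℕ∑.sum-replicate-zero n
∑-deg ((a , b) ∷ E) = begin
  ℕ∑.sum (deg ((a , b) ∷ E)) ≡⟨ ℕ∑.sum-cong-≗ (deg-∷ a b E) ⟩
  ℕ∑.sum (λ v → ι (δ a v) + (ι (δ b v) + deg E v))
    ≡⟨ ℕ∑.∑-distrib-+ (λ v → ι (δ a v)) (λ v → ι (δ b v) + deg E v) ⟩
  ℕ∑.sum (λ v → ι (δ a v)) + ℕ∑.sum (λ v → ι (δ b v) + deg E v)
    ≡⟨ cong₂ _+_ (∑-δ a) (ℕ∑.∑-distrib-+ (λ v → ι (δ b v)) (deg E)) ⟩
  1 + (ℕ∑.sum (λ v → ι (δ b v)) + ℕ∑.sum (deg E)) ≡⟨ cong suc (cong₂ _+_ (∑-δ b) (∑-deg E)) ⟩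
  2 + 2 * length E         ≡⟨ *-suc 2 (length E) ⟨
  2 * suc (length E)       ∎
  where open ≡-Reasoning

deg-cycle : ∀ m v → deg (cycle m) v ≤ 2
deg-cycle m v = subst (_≤ 2) (sym (split (allFin (suc m)))) (+-mono-≤
  (unique⇒occ≤1 v _ (Unique.allFin⁺ (suc m)))
  (unique⇒occ≤1 v _ (Unique.map⁺ next-injective (Unique.allFin⁺ (suc m)))))
  where
  split : ∀ xs → deg (map cycleEdge xs) v ≡ occ v xs + occ v (map next xs)
  split []       = refl
  split (x ∷ xs) = begin
    deg (map cycleEdge (x ∷ xs)) v            ≡⟨ deg-∷ x (next x) (map cycleEdge xs) v ⟩
    p + (q + deg (map cycleEdge xs) v)        ≡⟨ cong (λ d → p + (q + d)) (split xs) ⟩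
    p + (q + (occ v xs + occ v (map next xs))) ≡⟨ cong (p +_) (x∙yz≈y∙xz q (occ v xs) _) ⟩
    p + (occ v xs + (q + occ v (map next xs))) ≡⟨ +-assoc p _ _ ⟨
    p + occ v xs + (q + occ v (map next xs))  ∎
    where
    open ≡-Reasoning
    open import Algebra.Properties.CommutativeSemigroup +-commutativeSemigroup using (x∙yz≈y∙xz)
    p = ι (δ x v)
    q = ι (δ (next x) v)

below-average : ∀ {k} (f : Fin k → ℕ) t → ℕ∑.sum f < t * k → ∃ λ v → f v < t
below-average {zero}  f t lt = contradiction (subst (0 <_) (*-zeroʳ t) lt) λ()
below-average {suc k} f t lt with f zero <? t
... | yes p = zero , p
... | no ¬p with below-average (f ∘ suc) t (+-cancelˡ-< t _ _
                   (≤-<-trans (+-monoˡ-≤ (ℕ∑.sum (f ∘ suc)) (≮⇒≥ ¬p)) (subst (ℕ∑.sum f <_) (*-suc t k) lt)))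
...   | v , q = suc v , q

-- Averages the degree plus a penalty `t` per occurrence in `bad`: a value below `t` excludes even
-- one occurrence.
low-degree-outside : ∀ (E : List (Edge n)) bad t → 2 * length E + t * length bad < t * n →
                     ∃ λ y → y ∉ bad × deg E y < t
low-degree-outside E bad t lt with below-average (λ v → deg E v + t * occ v bad) t (subst (_< _) (sym eq) lt)
  where
  eq = trans (ℕ∑.∑-distrib-+ (deg E) (λ v → t * occ v bad))
         (cong₂ _+_ (∑-deg E) (trans (∑-*-distribˡ t (λ v → occ v bad)) (cong (t *_) (∑-occ bad))))
... | y , small = y ,
  (λ y∈ → <⇒≱ small (≤-trans (≤-trans (≤-reflexive (sym (*-identityʳ t))) (*-monoʳ-≤ t (∈⇒occ>0 y∈)))
                      (m≤n+m _ (deg E y)))) ,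
  ≤-<-trans (m≤m+n (deg E y) _) small

module Greedy {n} (C : List (Edge n)) (o : Fin n) (g t : ℕ) (1<g : 1 < g) where

  -- The vertex x is the current end of the growing trail; the last field says that its
  -- distance to o grows with every step until it reaches g.
  record Front (es : List (Edge n)) (x : Fin n) : Set where
    field
      unique : Unique (es ++ C)
      girth  : Girth (es ++ C) g
      degree : ∀ v → deg (es ++ C) v ≤ suc t
      end    : deg (es ++ C) x ≤ t
      away   : ∀ r → r ≤ g → r ≤ length es → Separated (es ++ C) o x r

  -- Degrees reach `suc t`, and `ball-size` adds one to the base.
  B : ℕ
  B = suc (suc t) ^ g

  step : ∀ {es x} → Front es x → ∀ bad {S W} → length es + length C ≤ S → length bad ≤ W →
         2 * S + t * (W + (B + B)) < t * n → ∃ λ y → y ∉ bad × Front ((y , x) ∷ es) y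
  step {es} {x} F bad {S} {W} es≤S bad≤W budget
    with low-degree-outside (es ++ C) (bad ++ ball H g x ++ ball H g o) t (≤-<-trans (+-mono-≤
           (*-monoʳ-≤ 2 (subst (_≤ S) (sym (length-++ es)) es≤S))
           (*-monoʳ-≤ t (subst (_≤ W + (B + B))
             (sym (trans (length-++ bad) (cong (length bad +_) (length-++ (ball H g x)))))
             (+-mono-≤ bad≤W (+-mono-≤ (ball-size H degree g x) (ball-size H degree g o)))))) budget)
    where
    open Front F
    H = es ++ C
  ... | y , y∉ , low = y , y∉ ∘ ∈-++⁺ˡ , record
    { unique = All.¬Any⇒All¬ H (separated⇒∉ 1<g sep-yx) ∷ unique
    ; girth  = girth-∷ girth sep-yx
    ; degree = degree'
    ; end    = end'
    ; away   = away'
    }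
    where
    open Front F
    H = es ++ C
    y∉x : y ∉ ball H g x
    y∉x = y∉ ∘ ∈-++⁺ʳ bad ∘ ∈-++⁺ˡ
    y∉0 : y ∉ ball H g o
    y∉0 = y∉ ∘ ∈-++⁺ʳ bad ∘ ∈-++⁺ʳ (ball H g x)
    x≢y : x ≢ y
    x≢y refl = y∉x (ball-centre H g x)
    sep-yx : Separated H y x g
    sep-yx Z ov j = ∉ball⇒separated g y∉x Z ov (Joins-sym {Z = Z} {y} {x} j)
    -- A vertex chosen with degree below `t` gains one edge on arrival and one on departure: hence
    -- `t` for the current end and `suc t` in general.
    end' : deg ((y , x) ∷ H) y ≤ t
    end' rewrite deg-∷ y x H y | dec-true (y ≟ y) refl | dec-false (x ≟ y) x≢y = low
    degree' : ∀ v → deg ((y , x) ∷ H) v ≤ suc t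
    degree' v rewrite deg-∷ y x H v with y ≟ v | x ≟ v
    ... | yes refl | yes refl = contradiction refl x≢y
    ... | yes refl | no _     = m≤n⇒m≤1+n low
    ... | no _     | yes refl = s≤s end
    ... | no _     | no _     = degree v
    away' : ∀ r → r ≤ g → r ≤ suc (length es) → Separated ((y , x) ∷ H) o y r
    away' zero    _   _   Z _ _ = z≤n
    away' (suc r) r<g r≤l = separated-∷ {t = o} {x} {y} (away r (<⇒≤ r<g) (s≤s⁻¹ r≤l))
      λ Z ov j → ≤-trans r<g (∉ball⇒separated g y∉0 Z ov j)

  -- `S` bounds the number of edges before the last step, so one budget inequality serves the whole
  -- leg, and later all phases. Only the end of a leg becomes a stop, so `bad` is recorded for it
  -- alone.
  walk : ∀ ℓ {es x} → Front es x → ∀ bad {S W} → ℓ + (length es + length C) ≤ S → length bad ≤ W →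
         2 * S + t * (W + (B + B)) < t * n →
         ∃₂ λ P y → length P ≡ suc ℓ × Joins y x P × y ∉ bad × Front (P ++ es) y
  walk zero {es} {x} F bad es≤S bad≤W budget =
    let y , y∉ , F' = step F bad es≤S bad≤W budget
    in (y , x) ∷ [] , y , refl , Joins-edge {a = y} {x} , y∉ , F'
  walk (suc ℓ) {es} {x} F bad {S} es≤S bad≤W budget =
    let y , _ , F' = step F bad (≤-trans (m≤n+m _ (suc ℓ)) es≤S) bad≤W budget
        P , z , len , j , z∉ , F'' = walk ℓ F' bad (subst (_≤ S) (sym (+-suc ℓ _)) es≤S) bad≤W budget
    in P ++ (y , x) ∷ [] , z , trans (length-++ P) (trans (+-comm (length P) 1) (cong suc len)) ,
       Joins-++ {Z = P} {(y , x) ∷ []} {z} {y} {x} j (Joins-edge {a = y} {x}) , z∉ ,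
       subst (λ l → Front l z) (sym (++-assoc P _ es)) F''

-- The stops omit the final vertex, so that routes concatenate and a closed route does not list its
-- base point twice. With all trails in one list, edge-disjointness is uniqueness of that list.
data Route {n} (L : ℕ) : Fin n → Fin n → List (Fin n) → List (Edge n) → Set where
  []  : ∀ {a} → Route L a a [] []
  leg : ∀ {a c b vs es} P → Joins a c P → length P ≤ L → Route L c b vs es → Route L a b (a ∷ vs) (P ++ es)

_▷_ : ∀ {L} {a b c : Fin n} {us vs es fs} → Route L a b us es → Route L b c vs fs →
      Route L a c (us ++ vs) (es ++ fs)
[] ▷ s = s
_▷_ {fs = fs} (leg {es = es} P j len r) s =
  subst (Route _ _ _ _) (sym (++-assoc P es fs)) (leg P j len (r ▷ s))

module Phases {m} (g t ℓ : ℕ) (1<g : 1 < g) (1<m : 1 < suc m) where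
  open Greedy (cycle (suc m)) zero g t 1<g

  private L = suc ℓ

  -- The route is built backwards: new legs are prepended, and it always ends at vertex 1.
  record Phase (M : ℕ) : Set where
    field
      es     : List (Edge (suc (suc m)))
      w      : Fin (suc (suc m))
      vs     : List (Fin (suc (suc m)))
      front  : Front es w
      route  : Route L w (suc zero) vs es
      ∣es∣   : length es ≡ M * L
      ∣vs∣   : length vs ≡ M
      0∉     : zero ∉ vs
      1∉     : suc zero ∉ vs
      spread : ∀ {v} → v ∈ vs → next v ∉ vs
      unique : Unique vs

  start : g ≤ suc (suc m) → 2 ≤ t → Phase 0
  start g≤ 2≤t = record
    { es = [] ; w = suc zero ; vs = [] ; route = [] ; ∣es∣ = refl ; ∣vs∣ = refl
    ; 0∉ = λ() ; 1∉ = λ() ; spread = λ() ; unique = []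
    ; front = record
      { unique = cycle-unique (suc m)
      ; girth  = λ Z ov closed len → cycle-girth (suc m) Z ov closed (<-≤-trans len g≤)
      ; degree = λ v → ≤-trans (deg-cycle (suc m) v) (m≤n⇒m≤1+n 2≤t)
      ; end    = ≤-trans (deg-cycle (suc m) (suc zero)) 2≤t
      -- Vertex 1 is adjacent to 0; with no edge added yet, only `r = 0` is asked for.
      ; away   = λ { zero _ _ Z _ _ → z≤n ; (suc _) _ () }
      }
    }

  extend : ∀ {M} S W → M * L + ℓ + suc (suc m) ≤ S → 2 + 3 * M ≤ W →
           2 * S + t * (W + (B + B)) < t * suc (suc m) → Phase M → Phase (suc M)
  extend {M} S W len≤S bad≤W budget ph with walk ℓ (Phase.front ph) bad
      (subst (_≤ S) eqS len≤S) (subst (_≤ W) eqW bad≤W) budget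
    where
    open Phase ph
    -- Excluding the cycle neighbours of earlier stops yields `spread`; 0 and 1 are reserved as the
    -- ends of the return arc.
    bad = zero ∷ suc zero ∷ vs ++ map next vs ++ map prev vs
    eqS : M * L + ℓ + suc (suc m) ≡ ℓ + (length es + length (cycle (suc m)))
    eqS rewrite ∣es∣ | length-cycle (suc m) = trans (cong (_+ suc (suc m)) (+-comm (M * L) ℓ)) (+-assoc ℓ (M * L) _)
    eqW : 2 + 3 * M ≡ length bad
    eqW rewrite length-++ vs {map next vs ++ map prev vs} | length-++ (map next vs) {map prev vs}
              | length-map next vs | length-map prev vs | ∣vs∣ | +-identityʳ M = refl
  ... | P , y , len , j , y∉ , F = record
    { es = P ++ es ; w = y ; vs = y ∷ vs ; front = F
    ; route  = leg P j (≤-reflexive len) route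
    ; ∣es∣   = trans (length-++ P) (cong₂ _+_ len ∣es∣)
    ; ∣vs∣   = cong suc ∣vs∣
    ; 0∉     = λ { (here refl) → y∉ (here refl) ; (there p) → 0∉ p }
    ; 1∉     = λ { (here refl) → y∉ (there (here refl)) ; (there p) → 1∉ p }
    ; spread = spread'
    ; unique = All.¬Any⇒All¬ vs (y∉ ∘ there ∘ there ∘ ∈-++⁺ˡ) ∷ unique
    }
    where
    open Phase ph
    spread' : ∀ {v} → v ∈ y ∷ vs → next v ∉ y ∷ vs
    spread' (here refl) (here eq) = next≢ (<⇒≤ 1<m) y eq
    spread' (here refl) (there p) = y∉ (there (there (∈-++⁺ʳ vs (∈-++⁺ʳ (map next vs)
      (subst (_∈ map prev vs) (prev-next y) (∈-map⁺ prev p))))))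
    spread' (there p) (here refl) = y∉ (there (there (∈-++⁺ʳ vs (∈-++⁺ˡ (∈-map⁺ next p)))))
    spread' (there p) (there q)   = spread p q

  grow : ∀ M S W → M * L + ℓ + suc (suc m) ≤ S → 2 + 3 * M ≤ W →
         2 * S + t * (W + (B + B)) < t * suc (suc m) → Phase 0 → Phase M
  grow zero    S W _ _ _ ph = ph
  grow (suc M) S W len≤S bad≤W budget ph =
    extend S W len≤S' bad≤W' budget (grow M S W len≤S' bad≤W' budget ph)
    where
    len≤S' = ≤-trans (+-monoˡ-≤ (suc (suc m)) (+-monoˡ-≤ ℓ (m≤n+m (M * L) L))) len≤S
    bad≤W' = ≤-trans (+-monoʳ-≤ 2 (*-monoʳ-≤ 3 (n≤1+n M))) bad≤W

-- Completing the tour along the cycle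

Chain : ∀ {m} → Fin (suc m) → List (Fin (suc m)) → Set
Chain v []       = next v ≡ zero
Chain v (x ∷ xs) = next v ≡ x × Chain x xs

tabulate-chain : ∀ {m k} (f : Fin (suc k) → Fin (suc m)) → (∀ i → next (f (inject₁ i)) ≡ f (suc i)) →
                 next (f (fromℕ k)) ≡ zero → Chain (f zero) (tabulate (f ∘ suc))
tabulate-chain {k = zero}  f step last = last
tabulate-chain {k = suc k} f step last = step zero , tabulate-chain (f ∘ suc) (step ∘ suc) last

module Arc {m} (vs : List (Fin (suc m))) (spread : ∀ {v} → v ∈ vs → next v ∉ vs) where

  open DecMembership (_≟_ {suc m}) using (_∈?_)

  fresh? : ∀ v → Dec (v ∉ vs)
  fresh? v = ¬? (v ∈? vs)

  private
    keep : ∀ {v xs} → v ∉ vs → v ∷ filter fresh? xs ≡ filter fresh? (v ∷ xs)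
    keep v∉ = sym (filter-accept fresh? v∉)

    drop : ∀ {v xs} → v ∈ vs → filter fresh? xs ≡ filter fresh? (v ∷ xs)
    drop v∈ = sym (filter-reject fresh? λ v∉ → v∉ v∈)

    one-leg : ∀ (v : Fin (suc m)) {ws es} → Route 2 (next v) zero ws es → Route 2 v zero (v ∷ ws) (cycleEdge v ∷ es)
    one-leg v = leg (cycleEdge v ∷ []) (Joins-edge {a = v} {next v}) (s≤s z≤n)

  -- By `spread` the successor of a stop is not a stop, so at most one vertex is skipped at a time
  -- and two cycle edges suffice for a leg. The second component lets the induction pass through a
  -- skipped vertex.
  arc : ∀ v xs → Chain v xs →
        (v ∉ vs → ∃ λ es → es ⊆ map cycleEdge (v ∷ xs) × Route 2 v zero (filter fresh? (v ∷ xs)) es) ×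
        (v ∈ vs → ∃ λ es → es ⊆ map cycleEdge xs × Route 2 (next v) zero (filter fresh? (v ∷ xs)) es)
  arc v [] last =
    (λ v∉ → cycleEdge v ∷ [] , ⊆-refl ,
       subst (λ l → Route 2 v zero l (cycleEdge v ∷ [])) (keep v∉)
         (one-leg v (subst (λ x → Route 2 x zero [] []) (sym last) []))) ,
    (λ v∈ → [] , ⊆-refl , subst₂ (λ x l → Route 2 x zero l []) (sym last) (drop v∈) [])
  arc v (x ∷ xs) (refl , ch) = out , skip
    where
    rest = arc x xs ch
    out : v ∉ vs → ∃ λ es → es ⊆ map cycleEdge (v ∷ x ∷ xs) × Route 2 v zero (filter fresh? (v ∷ x ∷ xs)) es
    out v∉ with x ∈? vs
    ... | no x∉ = let es , sub , r = proj₁ rest x∉ in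
      cycleEdge v ∷ es , refl ∷ sub ,
      subst (λ l → Route 2 v zero l (cycleEdge v ∷ es)) (keep v∉) (one-leg v r)
    ... | yes x∈ = let es , sub , r = proj₂ rest x∈ in
      cycleEdge v ∷ cycleEdge x ∷ es , refl ∷ refl ∷ sub ,
      subst (λ l → Route 2 v zero l (cycleEdge v ∷ cycleEdge x ∷ es)) (keep v∉)
        (leg (cycleEdge v ∷ cycleEdge x ∷ [])
          (Joins-∷ {Z = cycleEdge x ∷ []} {v} {x} {next x} (Joins-edge {a = x} {next x})) ≤-refl r)
    skip : v ∈ vs → ∃ λ es → es ⊆ map cycleEdge (x ∷ xs) × Route 2 x zero (filter fresh? (v ∷ x ∷ xs)) es
    skip v∈ = let es , sub , r = proj₁ rest (spread v∈) in
      es , sub , subst (λ l → Route 2 x zero l es) (drop v∈) r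

route-mono : ∀ {L L'} {a b : Fin n} {vs es} → L ≤ L' → Route L a b vs es → Route L' a b vs es
route-mono L≤ []               = []
route-mono L≤ (leg P j len r) = leg P j (≤-trans len L≤) (route-mono L≤ r)

-- From closed routes to tours

first : Fin n → List (Fin n) → Fin n
first b []      = b
first b (v ∷ _) = v

stop : Fin n → (vs : List (Fin n)) → Fin (length vs) → Fin n
stop b (v ∷ vs) zero    = first b vs
stop b (v ∷ vs) (suc i) = stop b vs i

stop-inject₁ : ∀ (b v : Fin n) vs i → stop b (v ∷ vs) (inject₁ i) ≡ lookup vs i
stop-inject₁ b v (w ∷ vs) zero    = refl
stop-inject₁ b v (w ∷ vs) (suc i) = stop-inject₁ b w vs i

stop-fromℕ : ∀ (b v : Fin n) vs → stop b (v ∷ vs) (fromℕ (length vs)) ≡ b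
stop-fromℕ b v []       = refl
stop-fromℕ b v (w ∷ vs) = stop-fromℕ b w vs

stop-closed : ∀ (v : Fin n) vs i → stop v (v ∷ vs) i ≡ lookup (v ∷ vs) (next i)
stop-closed v vs i with view i
... | ‵fromℕ          = trans (stop-fromℕ v v vs) (cong (lookup (v ∷ vs)) (sym (next-fromℕ (length vs))))
... | ‵inj₁ {i = j} _ = trans (stop-inject₁ v v vs j) (cong (lookup (v ∷ vs)) (sym (next-inject₁ j)))

route-first : ∀ {L} {a b : Fin n} {vs es} → Route L a b vs es → a ≡ first b vs
route-first []            = refl
route-first (leg _ _ _ _) = refl

record Legs (L : ℕ) {k} (from to : Fin k → Fin n) (es : List (Edge n)) : Set where
  field
    trail : Fin k → List (Edge n)
    total : concatTab trail ≡ es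
    short : ∀ i → length (trail i) ≤ L
    joins : ∀ i → Joins (from i) (to i) (trail i)

route-legs : ∀ {L} {a b : Fin n} {vs es} → Route L a b vs es → Legs L (lookup vs) (stop b vs) es
route-legs [] = record { trail = λ () ; total = refl ; short = λ () ; joins = λ () }
route-legs {n} {L} {b = b} (leg {a} {c} {vs = vs} P j len r) = record
  { trail = trail'
  ; total = cong (P ++_) total
  ; short = λ { zero → len ; (suc i) → short i }
  ; joins = λ { zero → subst (λ x → Joins a x P) (route-first r) j ; (suc i) → joins i }
  }
  where
  open Legs (route-legs r)
  trail' : Fin (suc (length vs)) → List (Edge n)
  trail' zero    = P
  trail' (suc i) = trail i

lookup-injective : ∀ {A : Set} {xs : List A} → Unique xs → ∀ i j → lookup xs i ≡ lookup xs j → i ≡ j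
lookup-injective (_ ∷ _)  zero    zero    eq = refl
lookup-injective {xs = _ ∷ xs} (x∉ ∷ _) zero (suc j) eq = contradiction eq (All.lookup x∉ (∈-lookup j))
lookup-injective {xs = _ ∷ xs} (x∉ ∷ _) (suc i) zero eq = contradiction (sym eq) (All.lookup x∉ (∈-lookup i))
lookup-injective (_ ∷ u)  (suc i) (suc j) eq = cong suc (lookup-injective u i j eq)

closed-route⇒tour : ∀ {m L} {a : Fin (suc m)} {vs es} → Route L a a (a ∷ vs) es →
                    Unique (a ∷ vs) → (∀ v → v ∈ a ∷ vs) →
                    ∃ λ (π : Tour m) → Legs L (edgeFst π) (edgeSnd π) es
closed-route⇒tour {m} {L} {a} {vs} {es} r unique complete =
  relabel (suc-injective (↔⇒≡ order)) order record
    { trail = trail ; total = total ; short = short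
    ; joins = λ i → subst (λ x → Joins (lookup (a ∷ vs) i) x (trail i)) (stop-closed a vs i) (joins i) }
  where
  open Legs (route-legs r)
  order : Permutation (suc (length vs)) (suc m)
  order = permutation (lookup (a ∷ vs)) (index ∘ complete) (λ v → sym (lookup-index (complete v)))
    (λ i → lookup-injective unique _ i (sym (lookup-index (complete (lookup (a ∷ vs) i)))))
  -- The length of `vs` equals `m` only propositionally; abstracting it allows matching on the
  -- equation.
  relabel : ∀ {k} → k ≡ m → (ρ : Permutation (suc k) (suc m)) →
            Legs L (ρ ⟨$⟩ʳ_) (λ i → ρ ⟨$⟩ʳ next i) es →
            ∃ λ (π : Tour m) → Legs L (edgeFst π) (edgeSnd π) es
  relabel refl ρ legs = ρ , legs

∑-one : ∀ k → ℕ∑.sum {k} (λ _ → 1) ≡ k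
∑-one zero    = refl
∑-one (suc k) = cong suc (∑-one k)

-- The optimum and the assembly of the hard instance

module _ {m} {E : List (Edge (suc m))} (loopless : ∀ a → (a , a) ∉ E) where

  private G = edgeGraph E loopless

  cost≥order : 0 < m → ∀ π → suc m ≤ cost G π
  cost≥order 0<m π = subst₂ _≤_ (∑-one (suc m))
    (sym (sumᴸ-allFin (λ i → dist G (edgeFst π i) (edgeSnd π i))))
    (∑-mono-≤ {f = λ _ → 1} λ i → dist-pos E loopless (next≢ 0<m i ∘ sym ∘ tour-injective π) z<s)

  cost-identity≤order : Over E (cycle m) → cost G idₚ ≤ suc m
  cost-identity≤order ov = subst₂ _≤_ (sym (sumᴸ-allFin (λ i → dist G i (next i))))
    (∑-one (suc m))
    (∑-mono-≤ {g = λ _ → 1} λ i → joins⇒dist≤ E loopless {i} {next i} (cycleEdge i ∷ [])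
      (All.lookup ov (cycleEdge∈ i) ∷ []) (Joins-edge {a = i} {next i}))

record HardInstance (m k c : ℕ) : Set where
  field
    graph     : Graph (suc m)
    connected : Connected graph
    tour      : Tour m
    k-optimal : KOptimal k graph tour
    cost-tour : c ≤ cost graph tour
    optimal   : Optimal graph idₚ
    cost-opt  : cost graph idₚ ≤ suc m

legs⇒instance : ∀ {m} (E : List (Edge (suc m))) {g k L} (π : Tour m) {es} → 1 < m → 1 < g → 1 ≤ k →
                L * k + L * k ≤ g → Girth E g → Unique E → Over E (cycle m) →
                Legs L (edgeFst π) (edgeSnd π) es → es ⊆ E → HardInstance m k (length es)
legs⇒instance {m} E {g} {k} {L} π {es} 1<m 1<g 1≤k 2Lk≤g girth unique cyc legs es⊆E = record
  { graph     = edgeGraph E loopless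
  ; connected = λ u v → let Z , ov , j , len = connect u v in
                  suc m , joins⇒reach E loopless (suc m) Z ov j len
  ; tour      = π
  ; k-optimal = λ π' → kmove-not-shorter 1<m girth loopless connect π trail over joins short trails-unique π' 2Lk≤g
  ; cost-tour = subst (λ es → length es ≤ cost (edgeGraph E loopless) π) total
                  (trails≤cost 1<m girth loopless connect π trail over joins short trails-unique
                    (≤-trans (+-mono-≤ L≤Lk L≤Lk) 2Lk≤g))
  ; optimal   = λ π' → ≤-trans (cost-identity≤order loopless cyc) (cost≥order loopless (<⇒≤ 1<m) π')
  ; cost-opt  = cost-identity≤order loopless cyc
  }
  where
  open Legs legs
  loopless = girth⇒loopless 1<g girth
  L≤Lk : L ≤ L * k
  L≤Lk = subst (_≤ L * k) (*-identityʳ L) (*-monoʳ-≤ L 1≤k)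
  connect : ∀ u v → ∃ λ Z → Over E Z × Joins u v Z × length Z ≤ suc m
  connect u v = let Z , ov , j , len = cycle-connects u v in Z , All.map (All.lookup cyc) ov , j , len
  trails⊆E : concatTab trail ⊆ E
  trails⊆E = subst (_⊆ E) (sym total) es⊆E
  trails-unique = unique-⊆ trails⊆E unique
  over : ∀ i → Over E (trail i)
  over i = All-resp-⊆ (⊆-trans (⊆-concatTab trail i) trails⊆E) (All.tabulate (λ e∈ → e∈))

-- `g ≤ q * suc ℓ` makes the walk long enough for its end to be far from 0, `1 ≤ ℓ` admits the
-- two-edge legs of the return arc, and the last hypothesis is the counting condition of `step` at
-- the final size.
hard-instance : ∀ {m g t} ℓ k q → 1 < suc m → 1 < g → 1 ≤ k → 1 ≤ ℓ → 2 ≤ t →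
                suc ℓ * k + suc ℓ * k ≤ g → g ≤ suc (suc m) → g ≤ q * suc ℓ →
                2 * (q * suc ℓ + ℓ + suc (suc m)) + t * (2 + 3 * q + (suc (suc t) ^ g + suc (suc t) ^ g))
                  < t * suc (suc m) →
                HardInstance (suc m) k (q * suc ℓ)
hard-instance {m} {g} {t} ℓ k q 1<m 1<g 1≤k 1≤ℓ 2≤t 2Lk≤g g≤n g≤qL budget =
  weaken (legs⇒instance H (proj₁ closed) 1<m 1<g 1≤k 2Lk≤g
    (girth-∷ (Front.girth front) far) (All.¬Any⇒All¬ _ (separated⇒∉ 1<g far) ∷ Front.unique front)
    -- The return arc starts at 1, so the cycle edge from 0 to 1 is passed over.
    (All.tabulate (λ e∈ → there (∈-++⁺ʳ es e∈))) (proj₂ closed) (refl ∷ ++⁺ ⊆-refl (cycleEdge zero ∷ʳ sub)))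
  where
  open Phases {m} g t ℓ 1<g 1<m
  open Greedy (cycle (suc m)) zero g t 1<g using (module Front)
  open Phase (grow q _ _ ≤-refl ≤-refl budget (start g≤n 2≤t))
  open Arc vs spread
  V = Fin (suc (suc m))
  H : List (Edge (suc (suc m)))
  H = (zero , w) ∷ es ++ cycle (suc m)
  far : Separated (es ++ cycle (suc m)) zero w g
  far = Front.away front g ≤-refl (subst (g ≤_) (sym ∣es∣) g≤qL)
  rest : List V
  rest = tabulate (λ i → suc i)
  chain : Chain (suc zero) (tabulate (λ i → suc (suc i)))
  chain = tabulate-chain suc (λ i → next-inject₁ (suc i)) (next-fromℕ (suc m))
  back : ∃ λ fs → fs ⊆ map cycleEdge rest × Route 2 (suc zero) zero (filter fresh? rest) fs
  back = proj₁ (arc (suc zero) (tabulate (λ i → suc (suc i))) chain) 1∉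
  fs  = proj₁ back
  sub = proj₁ (proj₂ back)
  whole : Route (suc ℓ) zero zero (zero ∷ vs ++ filter fresh? rest) ((zero , w) ∷ es ++ fs)
  whole = leg ((zero , w) ∷ []) (Joins-edge {a = zero} {w}) (s≤s z≤n) route
          ▷ route-mono (s≤s 1≤ℓ) (proj₂ (proj₂ back))
  rest-unique : Unique (zero ∷ rest)
  rest-unique = Unique.allFin⁺ (suc (suc m))
  all-unique : Unique (zero ∷ vs ++ filter fresh? rest)
  all-unique = All.¬Any⇒All¬ _ zero∉ ∷ Unique.++⁺ unique (Unique.filter⁺ fresh? (AllPairs-tail rest-unique))
    λ { (v∈ , v∈') → proj₂ (∈-filter⁻ fresh? {xs = rest} v∈') v∈ }
    where
    AllPairs-tail : ∀ {x : V} {xs} → Unique (x ∷ xs) → Unique xs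
    AllPairs-tail (_ ∷ u) = u
    zero∉ : zero ∉ vs ++ filter fresh? rest
    zero∉ p with ∈-++⁻ vs p
    ... | inj₁ q = 0∉ q
    ... | inj₂ q = Unique.Unique[x∷xs]⇒x∉xs rest-unique (proj₁ (∈-filter⁻ fresh? {xs = rest} q))
  complete : ∀ v → v ∈ zero ∷ vs ++ filter fresh? rest
  complete v with ∈-allFin v
  ... | here refl = here refl
  ... | there v∈ with v ∈? vs
    where open DecMembership (_≟_ {suc (suc m)}) using (_∈?_)
  ...   | yes v∈vs = there (∈-++⁺ˡ v∈vs)
  ...   | no v∉vs  = there (∈-++⁺ʳ vs (∈-filter⁺ fresh? v∈ v∉vs))
  closed = closed-route⇒tour whole all-unique complete
  weaken : HardInstance (suc m) k (length ((zero , w) ∷ es ++ fs)) → HardInstance (suc m) k (q * suc ℓ)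
  weaken h = record
    { graph = graph ; connected = connected ; tour = tour ; k-optimal = k-optimal
    ; optimal = optimal ; cost-opt = cost-opt
    ; cost-tour = ≤-trans (≤-trans (≤-reflexive (sym ∣es∣)) (≤-trans (m≤m+n (length es) (length fs))
        (≤-trans (≤-reflexive (sym (length-++ es))) (n≤1+n _)))) cost-tour
    }
    where open HardInstance h

-- Choice of the parameters

2*⌊n/2⌋≤n : ∀ n → 2 * ⌊ n /2⌋ ≤ n
2*⌊n/2⌋≤n n = begin
  2 * ⌊ n /2⌋         ≡⟨ cong (⌊ n /2⌋ +_) (+-identityʳ ⌊ n /2⌋) ⟩
  ⌊ n /2⌋ + ⌊ n /2⌋   ≤⟨ +-monoʳ-≤ ⌊ n /2⌋ (⌊n/2⌋≤⌈n/2⌉ n) ⟩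
  ⌊ n /2⌋ + ⌈ n /2⌉   ≡⟨ ⌊n/2⌋+⌈n/2⌉≡n n ⟩
  n                   ∎
  where open ≤-Reasoning

2^⌊log₂n⌋≤n : ∀ n → 0 < n → 2 ^ ⌊log₂ n ⌋ ≤ n
2^⌊log₂n⌋≤n = <-rec _ λ
  { (suc zero)    rec _ → ≤-refl
  ; (suc (suc n)) rec _ → step (suc (suc n)) (s≤s (s≤s z≤n)) (rec (⌊n/2⌋<n (suc n)) z<s)
  }
  where
  step : ∀ n → 2 ≤ n → 2 ^ ⌊log₂ ⌊ n /2⌋ ⌋ ≤ ⌊ n /2⌋ → 2 ^ ⌊log₂ n ⌋ ≤ n
  step n 2≤n ih = begin
    2 ^ ⌊log₂ n ⌋               ≡⟨ cong (2 ^_) (m+[n∸m]≡n {1} {⌊log₂ n ⌋} (⌊log₂⌋-mono-≤ 2≤n)) ⟨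
    2 * 2 ^ (⌊log₂ n ⌋ ∸ 1)     ≡⟨ cong (λ e → 2 * 2 ^ e) (⌊log₂⌊n/2⌋⌋≡⌊log₂n⌋∸1 n) ⟨
    2 * 2 ^ ⌊log₂ ⌊ n /2⌋ ⌋     ≤⟨ *-monoʳ-≤ 2 ih ⟩
    2 * ⌊ n /2⌋                 ≤⟨ 2*⌊n/2⌋≤n n ⟩
    n                           ∎
    where open ≤-Reasoning

n<2^[1+⌊log₂n⌋] : ∀ n → n < 2 ^ suc ⌊log₂ n ⌋
n<2^[1+⌊log₂n⌋] n = ≰⇒> λ le → 1+n≰n (subst (_≤ ⌊log₂ n ⌋) (⌊log₂[2^n]⌋≡n _) (⌊log₂⌋-mono-≤ le))

2^a≤n⇒a≤⌊log₂n⌋ : ∀ {a n} → 2 ^ a ≤ n → a ≤ ⌊log₂ n ⌋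
2^a≤n⇒a≤⌊log₂n⌋ {a} le = subst (_≤ _) (⌊log₂[2^n]⌋≡n a) (⌊log₂⌋-mono-≤ le)

n<2^n : ∀ n → n < 2 ^ n
n<2^n zero    = z<s
n<2^n (suc n) = begin-strict
  suc n          <⟨ s≤s (n<2^n n) ⟩
  1 + 2 ^ n      ≤⟨ +-monoˡ-≤ (2 ^ n) (m^n>0 2 n) ⟩
  2 ^ n + 2 ^ n  ≡⟨ cong (2 ^ n +_) (+-identityʳ (2 ^ n)) ⟨
  2 * 2 ^ n      ∎
  where open ≤-Reasoning

[4+n]²≤2^[4+n] : ∀ n → (4 + n) * (4 + n) ≤ 2 ^ (4 + n)
[4+n]²≤2^[4+n] zero    = ≤-refl
[4+n]²≤2^[4+n] (suc n) = begin
  (5 + n) * (5 + n)                          ≤⟨ m≤m+n _ (7 + 6 * n + n * n) ⟩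
  (5 + n) * (5 + n) + (7 + 6 * n + n * n)    ≡⟨ double n ⟩
  2 * ((4 + n) * (4 + n))                    ≤⟨ *-monoʳ-≤ 2 ([4+n]²≤2^[4+n] n) ⟩
  2 * 2 ^ (4 + n)                            ∎
  where
  open ≤-Reasoning
  double : ∀ n → (5 + n) * (5 + n) + (7 + 6 * n + n * n) ≡ 2 * ((4 + n) * (4 + n))
  double = solve-∀

n²≤2^n : ∀ n → 4 ≤ n → n * n ≤ 2 ^ n
n²≤2^n n 4≤n = subst (λ n → n * n ≤ 2 ^ n) (m+[n∸m]≡n 4≤n) ([4+n]²≤2^[4+n] (n ∸ 4))

-- The left side is about `(2ℓ + 18) q`, the right side `(4ℓ + 24) q`; `4 ≤ q` absorbs the lower
-- terms.
trail-budget : ∀ ℓ q n → 4 ≤ q → n ≤ 7 + q * 8 →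
               2 * (q * suc ℓ + ℓ + n) < 4 * ((6 + ℓ) * q)
trail-budget ℓ q n 4≤q n≤ = begin-strict
  2 * (q * suc ℓ + ℓ + n)             ≤⟨ *-monoʳ-≤ 2 (+-monoʳ-≤ (q * suc ℓ + ℓ) n≤) ⟩
  2 * (q * suc ℓ + ℓ + (7 + q * 8))   <⟨ subst (λ q → 2 * (q * suc ℓ + ℓ + (7 + q * 8)) < 4 * ((6 + ℓ) * q))
                                           (m+[n∸m]≡n 4≤q) (≤-trans (m≤m+n _ _) (≤-reflexive (gap ℓ (q ∸ 4)))) ⟩
  4 * ((6 + ℓ) * q)                   ∎
  where
  open ≤-Reasoning
  gap : ∀ ℓ p → suc (2 * ((4 + p) * suc ℓ + ℓ + (7 + (4 + p) * 8))) + (9 + 6 * ℓ + 6 * p + 2 * (p * ℓ))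
              ≡ 4 * ((6 + ℓ) * (4 + p))
  gap = solve-∀

-- With `n` about `8q`, half of the right side pays for the degrees and half for forbidden vertices:
-- `3q` for stops and their cycle neighbours, at most `q` for 0, 1 and the two balls.
greedy-budget : ∀ ℓ q B n → 1 ≤ B → 4 * B ≤ q → n ≤ 7 + q * 8 → q * 8 ≤ n →
                2 * (q * suc ℓ + ℓ + n) + (6 + ℓ) * (2 + 3 * q + (B + B)) < (6 + ℓ) * n
greedy-budget ℓ q B n 1≤B 4B≤q n≤ n≥ = begin-strict
  2 * (q * suc ℓ + ℓ + n) + (6 + ℓ) * (2 + 3 * q + (B + B))
    <⟨ +-mono-<-≤ (trail-budget ℓ q n (≤-trans (*-monoʳ-≤ 4 1≤B) 4B≤q) n≤) (*-monoʳ-≤ (6 + ℓ) bad) ⟩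
  4 * ((6 + ℓ) * q) + (6 + ℓ) * (4 * q) ≡⟨ collect ℓ q ⟩
  (6 + ℓ) * (q * 8)                     ≤⟨ *-monoʳ-≤ (6 + ℓ) n≥ ⟩
  (6 + ℓ) * n                           ∎
  where
  open ≤-Reasoning
  collect : ∀ ℓ q → 4 * ((6 + ℓ) * q) + (6 + ℓ) * (4 * q) ≡ (6 + ℓ) * (q * 8)
  collect = solve-∀
  rearrange : ∀ B q → (2 * B + 3 * q) + (B + B) ≡ 4 * B + 3 * q
  rearrange = solve-∀
  bad : 2 + 3 * q + (B + B) ≤ 4 * q
  bad = begin
    2 + 3 * q + (B + B)       ≤⟨ +-monoˡ-≤ (B + B) (+-monoˡ-≤ (3 * q) (*-monoʳ-≤ 2 1≤B)) ⟩
    2 * B + 3 * q + (B + B)   ≡⟨ rearrange B q ⟩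
    4 * B + 3 * q             ≤⟨ +-monoˡ-≤ (3 * q) 4B≤q ⟩
    4 * q                     ∎

module Parameters (n k : ℕ) (2≤k : 2 ≤ k) (16k≤λ : 16 * k ≤ ⌊log₂ ⌊log₂ n ⌋ ⌋) (0<n : 0 < n) where

  a l d : ℕ
  a = ⌊log₂ n ⌋
  l = ⌊log₂ a ⌋
  -- The 8 gives `e + e ≤ a`: as `suc l ≤ 2 * l`, the exponent `e` is at most `4 * k * l * L`, half
  -- of `L * d`.
  d = 8 * k * l

  32≤l : 32 ≤ l
  32≤l = ≤-trans (*-monoʳ-≤ 16 2≤k) 16k≤λ

  0<l : 0 < l
  0<l = ≤-trans (s≤s z≤n) 32≤l

  0<a : 0 < a
  0<a = n≢0⇒n>0 λ a≡0 → <⇒≱ 0<l (≤-reflexive (cong ⌊log₂_⌋ a≡0))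

  instance
    d≢0 : NonZero d
    d≢0 = >-nonZero (≤-trans (≤-trans (s≤s z≤n) (*-monoʳ-≤ 8 2≤k)) (≤-trans (≤-reflexive (sym (*-identityʳ (8 * k)))) (*-monoʳ-≤ (8 * k) 0<l)))

  L q : ℕ
  L = a / d
  q = n / 8

  -- This is where `n` must be large in terms of `k`; it makes `L` at least 2.
  2d≤a : 2 * d ≤ a
  2d≤a = begin
    2 * (8 * k * l)  ≡⟨ eq k l ⟩
    16 * k * l       ≤⟨ *-monoˡ-≤ l 16k≤λ ⟩
    l * l            ≤⟨ n²≤2^n l (≤-trans (s≤s (s≤s (s≤s (s≤s z≤n)))) 32≤l) ⟩
    2 ^ l            ≤⟨ 2^⌊log₂n⌋≤n a 0<a ⟩
    a                ∎
    where
    open ≤-Reasoning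
    eq : ∀ k l → 2 * (8 * k * l) ≡ 16 * k * l
    eq = solve-∀

  2≤L : 2 ≤ L
  2≤L = subst (_≤ L) (m*n/n≡m 2 d) (/-monoˡ-≤ d 2d≤a)

  Ld≤a : L * d ≤ a
  Ld≤a = m/n*n≤m a d

  a≤2Ld : a ≤ 2 * (L * d)
  a≤2Ld = begin
    a                ≡⟨ m≡m%n+[m/n]*n a d ⟩
    a % d + L * d    ≤⟨ +-monoˡ-≤ (L * d) (<⇒≤ (m%n<n a d)) ⟩
    d + L * d        ≤⟨ +-monoˡ-≤ (L * d) (≤-trans (≤-reflexive (sym (*-identityˡ d))) (*-monoˡ-≤ d (<⇒≤ 2≤L))) ⟩
    L * d + L * d    ≡⟨ cong (L * d +_) (+-identityʳ (L * d)) ⟨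
    2 * (L * d)      ∎
    where open ≤-Reasoning

  g e B : ℕ
  g = L * k + L * k
  e = suc l * g
  B = (7 + L) ^ g

  L≤g : L ≤ g
  L≤g = ≤-trans (≤-trans (≤-reflexive (sym (*-identityʳ L))) (*-monoʳ-≤ L (<⇒≤ 2≤k))) (m≤m+n (L * k) (L * k))

  2e≤a : e + e ≤ a
  2e≤a = begin
    suc l * g + suc l * g              ≤⟨ +-mono-≤ (*-monoˡ-≤ g (+-monoˡ-≤ l 0<l)) (*-monoˡ-≤ g (+-monoˡ-≤ l 0<l)) ⟩
    (l + l) * g + (l + l) * g          ≡⟨ eq L k l ⟩
    L * (8 * k * l)                    ≤⟨ Ld≤a ⟩
    a                                  ∎
    where
    open ≤-Reasoning
    eq : ∀ L k l → (l + l) * (L * k + L * k) + (l + l) * (L * k + L * k) ≡ L * (8 * k * l)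
    eq = solve-∀

  5≤e : 5 ≤ e
  5≤e = begin
    5          ≤⟨ s≤s (s≤s (s≤s (s≤s (s≤s z≤n)))) ⟩
    33 * 1     ≤⟨ *-mono-≤ (s≤s 32≤l) (≤-trans (<⇒≤ 2≤L) L≤g) ⟩
    suc l * g  ∎
    where open ≤-Reasoning

  7+L≤2^[1+l] : 7 + L ≤ 2 ^ suc l
  7+L≤2^[1+l] = begin
    7 + L         ≤⟨ +-monoˡ-≤ L (*-monoʳ-≤ 7 (<⇒≤ 2≤L)) ⟩
    7 * L + L     ≡⟨ eq L ⟩
    L * 8         ≤⟨ *-monoʳ-≤ L (≤-trans (≤-trans (≤-reflexive (sym (*-identityʳ 8))) (*-monoʳ-≤ 8 (<⇒≤ 2≤k)))
                       (≤-trans (≤-reflexive (sym (*-identityʳ (8 * k)))) (*-monoʳ-≤ (8 * k) 0<l))) ⟩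
    L * d         ≤⟨ Ld≤a ⟩
    a             ≤⟨ <⇒≤ (n<2^[1+⌊log₂n⌋] a) ⟩
    2 ^ suc l     ∎
    where
    open ≤-Reasoning
    eq : ∀ L → 7 * L + L ≡ L * 8
    eq = solve-∀

  -- `B` is at most `2 ^ e`, and `5 ≤ e` lets the spare copy of `e` in `e + e ≤ a` absorb the factor
  -- 32.
  32B≤n : 4 * B * 8 ≤ n
  32B≤n = begin
    4 * B * 8                   ≡⟨ eq B ⟩
    2 ^ 5 * B                   ≤⟨ *-monoʳ-≤ (2 ^ 5) (^-monoˡ-≤ g 7+L≤2^[1+l]) ⟩
    2 ^ 5 * (2 ^ suc l) ^ g     ≡⟨ cong (2 ^ 5 *_) (^-*-assoc 2 (suc l) g) ⟩
    2 ^ 5 * 2 ^ e               ≡⟨ ^-distribˡ-+-* 2 5 e ⟨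
    2 ^ (5 + e)                 ≤⟨ ^-monoʳ-≤ 2 (≤-trans (+-monoˡ-≤ e 5≤e) 2e≤a) ⟩
    2 ^ a                       ≤⟨ 2^⌊log₂n⌋≤n n 0<n ⟩
    n                           ∎
    where
    open ≤-Reasoning
    eq : ∀ B → 4 * B * 8 ≡ 32 * B
    eq = solve-∀

  4B≤q : 4 * B ≤ q
  4B≤q = subst (_≤ q) (m*n/n≡m (4 * B) 8) (/-monoˡ-≤ 8 32B≤n)

  1≤B : 1 ≤ B
  1≤B = m^n>0 (7 + L) g

  g≤q : g ≤ q
  g≤q = begin
    g      ≤⟨ <⇒≤ (n<2^n g) ⟩
    2 ^ g  ≤⟨ ^-monoˡ-≤ g (s≤s (s≤s z≤n)) ⟩
    B      ≤⟨ m≤n*m B 4 ⟩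
    4 * B  ≤⟨ 4B≤q ⟩
    q      ∎
    where open ≤-Reasoning

  8q≤n : q * 8 ≤ n
  8q≤n = m/n*n≤m n 8

  n≤7+8q : n ≤ 7 + q * 8
  n≤7+8q = ≤-trans (≤-reflexive (m≡m%n+[m/n]*n n 8)) (+-monoˡ-≤ (q * 8) (s≤s⁻¹ (m%n<n n 8)))

  4≤q : 4 ≤ q
  4≤q = ≤-trans (*-monoʳ-≤ 4 1≤B) 4B≤q

  q≤n : q ≤ n
  q≤n = ≤-trans (m≤m*n q 8) 8q≤n

  -- The 256 is 16 times 16: each of `a ≤ 16 k l L` and `n ≤ 16 q` loses a factor 2 by rounding down
  -- a quotient by a multiple of 8.
  ratio : ∀ {opt cost} → opt ≤ n → q * L ≤ cost → a * opt ≤ 256 * k * l * cost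
  ratio {opt} {cost} opt≤ cost≥ = begin
    a * opt                          ≤⟨ *-mono-≤ a≤2Ld (≤-trans opt≤ (≤-trans n≤7+8q (+-monoˡ-≤ (q * 8) (≤-trans (n≤1+n 7) (*-monoˡ-≤ 8 (≤-trans (s≤s z≤n) 4≤q)))))) ⟩
    2 * (L * (8 * k * l)) * (q * 8 + q * 8) ≡⟨ eq L k l q ⟩
    256 * k * l * (q * L)            ≤⟨ *-monoʳ-≤ (256 * k * l) cost≥ ⟩
    256 * k * l * cost               ∎
    where
    open ≤-Reasoning
    eq : ∀ L k l q → 2 * (L * (8 * k * l)) * (q * 8 + q * 8) ≡ 256 * k * l * (q * L)
    eq = solve-∀

  hard : ∀ {m} → n ≡ suc m → HardInstance m k (q * L)
  hard {zero}  n≡ = contradiction (≤-trans (≤-trans 4≤q q≤n) (≤-reflexive n≡)) λ { (s≤s ()) }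
  hard {suc m} n≡ = subst (λ x → HardInstance (suc m) k (q * x)) L≡
    (hard-instance ℓ k q
      (s≤s⁻¹ (≤-trans (s≤s (s≤s (s≤s z≤n))) (≤-trans 4≤q (≤-trans q≤n (≤-reflexive n≡)))))
      (≤-trans 2≤L L≤g) (<⇒≤ 2≤k) (s≤s⁻¹ (subst (2 ≤_) (sym L≡) 2≤L)) (s≤s (s≤s z≤n))
      (≤-reflexive (cong (λ x → x * k + x * k) L≡))
      (≤-trans g≤q (≤-trans q≤n (≤-reflexive n≡)))
      (≤-trans g≤q (m≤m*n q (suc ℓ)))
      (subst (λ n → 2 * (q * suc ℓ + ℓ + n) + (6 + ℓ) * (2 + 3 * q + ((8 + ℓ) ^ g + (8 + ℓ) ^ g)) < (6 + ℓ) * n) n≡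
        (greedy-budget ℓ q ((8 + ℓ) ^ g) n (m^n>0 (8 + ℓ) g)
          (subst (λ x → 4 * (7 + x) ^ g ≤ q) (sym L≡) 4B≤q) n≤7+8q 8q≤n)))
    where
    ℓ = L ∸ 1
    L≡ : suc ℓ ≡ L
    L≡ = m+[n∸m]≡n {1} (<⇒≤ 2≤L)

theorem8 : (k : ℕ) → 2 ≤ k →
    Σ ℕ λ c → 0 < c × Σ ℕ λ N → (m : ℕ) → N ≤ suc m →
    Σ (Graph (suc m)) λ G → Connected G × Σ (Tour m) λ T → KOptimal k G T ×
    Σ (Tour m) λ Topt → Optimal G Topt ×
    ⌊log₂ (suc m) ⌋ * cost G Topt ≤ c * ⌊log₂ ⌊log₂ (suc m) ⌋ ⌋ * cost G T
theorem8 k 2≤k = 256 * k , *-monoʳ-< 256 (<⇒≤ 2≤k) , 2 ^ 2 ^ (16 * k) , λ m N≤n →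
  let open Parameters (suc m) k 2≤k (2^a≤n⇒a≤⌊log₂n⌋ (2^a≤n⇒a≤⌊log₂n⌋ N≤n)) z<s
      open HardInstance (hard refl)
  in graph , connected , tour , k-optimal , idₚ , optimal , ratio cost-opt cost-tour
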